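{- For every finite connected weighted graph $G=(V,E,w)$ with $|V|=n\ge2$ and $w:E\to\mathbb{R}_{>0}$, $$1\le\frac{\operatorname{OPT}_{\mathrm{card}}(G,w)}{\operatorname{OPT}_{\mathrm{free}}(G,w)}\le\frac{2n-1}{3}.$$ The upper factor is best possible for every $n\ge2$: equality $\operatorname{OPT}_{\mathrm{card}}/\operatorname{OPT}_{\mathrm{free}}=(2n-1)/3$ holds for the unweighted complete graph $K_n$ (all edge weights equal to $1$).
   Context: $d_G$ is the shortest-path metric of the support graph $(V,E)$ with every edge of length $1$; the weights are not edge lengths. An ultrametric on $V$ is a metric $u$ with $u(x,y)\le\max\{u(x,z),u(z,y)\}$ for all $x,y,z$. $\operatorname{OPT}_{\mathrm{free}}(G,w)$ is the minimum of $\sum_{xy\in E}w_{xy}u(x,y)$ over all ultrametrics $u$ on $V$ with $u(x,y)\ge d_G(x,y)$ for all $x,y\in V$ (the minimum is attained). A rooted binary hierarchy $H$ on $V$ is a rooted tree whose leaves are the vertices of $V$ and whose internal nodes have exactly two children; each node is identified with the set of leaves below it (a cluster), and $C_H(x,y)$ is the cluster of the lowest common ancestor of $x,y$. Put $h_H(x,x)=0$ and $h_H(x,y)=|C_H(x,y)|-1$ for $x\ne y$. $\operatorname{OPT}_{\mathrm{card}}(G,w)$ is the minimum of $\sum_{xy\in E}w_{xy}h_H(x,y)$ over all rooted binary hierarchies $H$ on $V$ with $h_H(x,y)\ge d_G(x,y)$ for all $x,y\in V$. -}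

module Defs where

open import Algebra.Bundles using (CommutativeRing)
open import Algebra.Core using (Op₁; Op₂)
open import Algebra.Structures using (IsCommutativeRing)
import Algebra.Construct.NaturalChoice.Max as Max
import Algebra.Definitions.RawMonoid as RawMonoidOps
import Algebra.Properties.Ring as RingProperties
open import Data.Bool.Base using (Bool; if_then_else_; _∧_)
open import Data.Empty using (⊥-elim)
open import Data.Fin.Base using (Fin) renaming (_<_ to _<ᶠ_)
open import Data.Fin.Properties using (_≟_; any?) renaming (_<?_ to _<ᶠ?_)
open import Data.List.Base using (List; foldr; map; filter; length; allFin; cartesianProduct)
import Data.List.Membership.DecPropositional as DecMembership
open import Data.List.Relation.Binary.Permutation.Propositional using (_↭_)
open import Data.Nat.Base using (ℕ; zero; suc; z≤n; s≤s) renaming (_≤_ to _≤ℕ_; _∸_ to _∸ℕ_)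
open import Data.Product.Base using (Σ-syntax; ∃; ∃-syntax; _×_; _,_; proj₁; proj₂)
open import Data.Sum.Base using (inj₁; inj₂)
open import Data.Tree.Binary using (Tree; leaf; node; module Leaves)
open import Data.Unit.Base using (⊤; tt)
open import Function.Metric.Definitions using (TriangleInequality)
open import Function.Metric.Structures using (IsGeneralMetric)
open import Level using (0ℓ)
open import Relation.Binary.Bundles using (TotalOrder)
open import Relation.Binary.Core using (Rel)
import Relation.Binary.Construct.NonStrictToStrict as NonStrictToStrict
open import Relation.Binary.Definitions using (Decidable; Symmetric; Irreflexive)
open import Relation.Binary.PropositionalEquality using (_≡_; refl)
open import Relation.Binary.Structures using (IsDecTotalOrder)
open import Relation.Nullary.Decidable using (Dec; yes; no; does; map′; _×-dec_; ¬?)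
open import Relation.Nullary.Negation using (¬_)

-- The real numbers in their classical axiomatisation, as a Dedekind-complete
-- ordered field; these axioms determine ℝ up to isomorphism.  The order is
-- decidable because the classical order on ℝ is total and satisfies
-- trichotomy.
record RealNumbers : Set₁ where
  infix  8 -_
  infixl 7 _*_
  infixl 6 _+_
  infix  4 _≈_ _≤_
  field
    Carrier : Set
    _≈_ _≤_ : Rel Carrier 0ℓ
    _+_ _*_ : Op₂ Carrier
    -_      : Op₁ Carrier
    0# 1#   : Carrier

    isCommutativeRing : IsCommutativeRing _≈_ _+_ _*_ -_ 0# 1#
    0≉1               : ¬ 0# ≈ 1#
    inv               : ∀ x → ¬ x ≈ 0# → Carrier
    *-inv             : ∀ x (x≉0 : ¬ x ≈ 0#) → x * inv x x≉0 ≈ 1#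

    isDecTotalOrder : IsDecTotalOrder _≈_ _≤_
    +-monoˡ-≤       : ∀ z {x y} → x ≤ y → x + z ≤ y + z
    *-nonNegative   : ∀ {x y} → 0# ≤ x → 0# ≤ y → 0# ≤ x * y

  IsUpperBound : (Carrier → Set) → Carrier → Set
  IsUpperBound P b = ∀ {x} → P x → x ≤ b

  field
    complete : (P : Carrier → Set) → ∃ P → ∃ (IsUpperBound P) →
               ∃[ s ] IsUpperBound P s × (∀ b → IsUpperBound P b → s ≤ b)

  commutativeRing : CommutativeRing 0ℓ 0ℓ
  commutativeRing = record { isCommutativeRing = isCommutativeRing }

  module O = IsDecTotalOrder isDecTotalOrder
  module R = CommutativeRing commutativeRing

  totalOrder : TotalOrder 0ℓ 0ℓ 0ℓ
  totalOrder = record { isTotalOrder = O.isTotalOrder }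

  open R public using (_-_)
  open Max totalOrder public using (_⊔_)
  open NonStrictToStrict _≈_ _≤_ public using (_<_)

  infixl 7 _/_[_]
  _/_[_] : ∀ x y → ¬ y ≈ 0# → Carrier
  x / y [ y≉0 ] = x * inv y y≉0

  fromℕ : ℕ → Carrier
  fromℕ n = RawMonoidOps._×_ R.+-rawMonoid n 1#

  sum : List Carrier → Carrier
  sum = foldr _+_ 0#

  0≤1 : 0# ≤ 1#
  0≤1 with O.total 0# 1#
  ... | inj₁ 0≤1′ = 0≤1′
  ... | inj₂ 1≤0 = O.≤-respʳ-≈ -1*-1≈1 (*-nonNegative 0≤-1 0≤-1)
    where
    open RingProperties R.ring using (-1*x≈-x; -‿involutive)
    0≤-1 : 0# ≤ - 1#
    0≤-1 = O.≤-respˡ-≈ (R.-‿inverseʳ 1#)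
             (O.≤-respʳ-≈ (R.+-identityˡ (- 1#)) (+-monoˡ-≤ (- 1#) 1≤0))
    -1*-1≈1 : - 1# * - 1# ≈ 1#
    -1*-1≈1 = R.trans (-1*x≈-x (- 1#)) (-‿involutive 1#)

  0<1 : 0# < 1#
  0<1 = 0≤1 , 0≉1

  1≤fromℕ-suc : ∀ n → 1# ≤ fromℕ (suc n)
  1≤fromℕ-suc zero    = O.reflexive (R.sym (R.+-identityʳ 1#))
  1≤fromℕ-suc (suc n) = O.trans (1≤fromℕ-suc n)
    (O.≤-respˡ-≈ (R.+-identityˡ _) (+-monoˡ-≤ (fromℕ (suc n)) 0≤1))

  fromℕ-suc≉0 : ∀ n → ¬ fromℕ (suc n) ≈ 0#
  fromℕ-suc≉0 n eq = 0≉1 (O.antisym 0≤1 (O.≤-respʳ-≈ eq (1≤fromℕ-suc n)))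

least : {P : ℕ → Set} → (∀ k → Dec (P k)) → ∀ m → P m →
        ∃[ k ] P k × (∀ j → P j → k ≤ℕ j)
least P? zero p = zero , p , λ _ _ → z≤n
least {P} P? (suc m) p with P? zero
... | yes p₀ = zero , p₀ , λ _ _ → z≤n
... | no ¬p₀ with least (λ k → P? (suc k)) m p
...   | k , pk , min = suc k , pk , bound
  where
  bound : ∀ j → P j → suc k ≤ℕ j
  bound zero    p₀ = ⊥-elim (¬p₀ p₀)
  bound (suc j) pj = s≤s (min j pj)

data Walk {V : Set} (_~_ : Rel V 0ℓ) : ℕ → Rel V 0ℓ where
  []  : ∀ {x} → Walk _~_ zero x x
  _∷_ : ∀ {k x y z} → x ~ y → Walk _~_ k y z → Walk _~_ (suc k) x z

record ConnectedGraph (n : ℕ) : Set₁ where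
  infix 4 _~_ _~?_
  field
    _~_      : Rel (Fin n) 0ℓ
    _~?_     : Decidable _~_
    ~-sym    : Symmetric _~_
    ~-irrefl : Irreflexive _≡_ _~_

    connected : ∀ x y → ∃[ k ] Walk _~_ k x y

  walk? : ∀ k → Decidable (Walk _~_ k)
  walk? zero x y = map′ (λ { refl → [] }) (λ { [] → refl }) (x ≟ y)
  walk? (suc k) x z =
    map′ (λ { (_ , e , p) → e ∷ p }) (λ { (e ∷ p) → _ , e , p })
         (any? λ y → (x ~? y) ×-dec walk? k y z)

  shortestWalk : ∀ x y → ∃[ k ] Walk _~_ k x y × (∀ j → Walk _~_ j x y → k ≤ℕ j)
  shortestWalk x y =
    least (λ k → walk? k x y) (proj₁ (connected x y)) (proj₂ (connected x y))

  dist : Fin n → Fin n → ℕ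
  dist x y = proj₁ (shortestWalk x y)

  -- Each undirected edge occurs once, as the pair with x < y.
  edges : List (Fin n × Fin n)
  edges = filter (λ (x , y) → (x <ᶠ? y) ×-dec (x ~? y))
                 (cartesianProduct (allFin n) (allFin n))

-- Internal nodes have exactly two children and carry no data.  The children
-- are ordered here, but nothing below depends on that order.
record Hierarchy (n : ℕ) : Set where
  field
    tree     : Tree ⊤ (Fin n)
    leaves-↭ : Leaves.toList tree ↭ allFin n

module _ {n : ℕ} where
  open DecMembership (_≟_ {n}) using (_∈?_)

  cluster : Tree ⊤ (Fin n) → List (Fin n)
  cluster = Leaves.toList

  contains : Tree ⊤ (Fin n) → Fin n → Fin n → Bool
  contains t x y = does (x ∈? cluster t) ∧ does (y ∈? cluster t)

  -- The lowest node above both x and y, for x and y leaves of the tree.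
  lca : Tree ⊤ (Fin n) → Fin n → Fin n → Tree ⊤ (Fin n)
  lca (leaf v)     x y = leaf v
  lca (node l _ r) x y =
    if contains l x y then lca l x y
    else if contains r x y then lca r x y
    else node l tt r

  height : Hierarchy n → Fin n → Fin n → ℕ
  height H x y =
    if does (x ≟ y) then 0
    else length (cluster (lca (Hierarchy.tree H) x y)) ∸ℕ 1

complete-graph : ∀ n → ConnectedGraph n
complete-graph n = record
  { _~_       = λ x y → ¬ x ≡ y
  ; _~?_      = λ x y → ¬? (x ≟ y)
  ; ~-sym     = λ x≢y → λ { refl → x≢y refl }
  ; ~-irrefl  = λ x≡y x≢y → x≢y x≡y
  ; connected = conn
  }
  where
  conn : ∀ x y → ∃[ k ] Walk (λ x y → ¬ x ≡ y) k x y
  conn x y with x ≟ y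
  ... | yes refl = zero , []
  ... | no x≢y   = 1 , x≢y ∷ []

module Optimisation (ℝ : RealNumbers) where
  open RealNumbers ℝ public

  -- weight is a function on edges: its values off the edge set are never used.
  record WeightedGraph (n : ℕ) : Set₁ where
    field
      graph : ConnectedGraph n
    open ConnectedGraph graph public
    field
      weight          : Fin n → Fin n → Carrier
      weight-sym      : ∀ {x y} → x ~ y → weight x y ≈ weight y x
      weight-positive : ∀ {x y} → x ~ y → 0# < weight x y

    cost : (Fin n → Fin n → Carrier) → Carrier
    cost u = sum (map (λ (x , y) → weight x y * u x y) edges)

  record IsUltrametric {n : ℕ} (u : Fin n → Fin n → Carrier) : Set where
    field
      isMetric      : IsGeneralMetric _≡_ _≈_ _≤_ 0# _+_ u
      ultraTriangle : TriangleInequality _≤_ _⊔_ u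

  IsMinimum : {A : Set} → (A → Set) → (A → Carrier) → Carrier → Set
  IsMinimum Feasible f m =
    (∃[ a ] Feasible a × f a ≈ m) × (∀ a → Feasible a → m ≤ f a)

  module _ {n : ℕ} (G : WeightedGraph n) where
    open WeightedGraph G

    IsOPTfree : Carrier → Set
    IsOPTfree = IsMinimum
      (λ u → IsUltrametric u × (∀ x y → fromℕ (dist x y) ≤ u x y))
      cost

    IsOPTcard : Carrier → Set
    IsOPTcard = IsMinimum
      (λ H → ∀ x y → dist x y ≤ℕ height H x y)
      (λ H → cost (λ x y → fromℕ (height H x y)))

    -- Both minima exist, the second is nonzero, and their quotient is ρ.
    IsOPTratio : Carrier → Set
    IsOPTratio ρ =
      ∃[ a ] ∃[ b ] IsOPTcard a × IsOPTfree b ×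
      (Σ[ b≉0 ∈ ¬ b ≈ 0# ] ρ ≈ a / b [ b≉0 ])

  K : ∀ n → WeightedGraph n
  K n = record
    { graph           = complete-graph n
    ; weight          = λ _ _ → 1#
    ; weight-sym      = λ _ → R.refl
    ; weight-positive = λ _ → 0<1
    }

module Submission where

-- Both optima are minima over rooted binary hierarchies, and both are compared
-- with the total weight W of the graph.
--
-- A function g on clusters that grows towards the root turns a hierarchy into
-- the ultrametric g (lca x y) (treeUltrametric).  Three choices of g matter:
-- the number of leaves minus one, which is the cardinality height; the diameter
-- in the graph metric; and the constant 1.  By the first choice a hierarchy
-- feasible for OPTcard is an ultrametric feasible for OPTfree, so
-- OPTfree ≤ OPTcard (OPTfree≤OPTcard).
--
-- By the second choice OPTfree is a minimum over finitely many hierarchies.  For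
-- a feasible ultrametric u, inserting the vertices one by one builds a hierarchy
-- in which every node separates only pairs whose u-distance is the u-diameter of
-- the node (aggregate).  Since u dominates the graph metric, the graph diameter
-- of lca x y is then at most u x y (diameter-dominates).
--
-- For the upper factor, u ≥ 1 on edges gives W ≤ OPTfree, so it suffices to find
-- a feasible hierarchy with 3 cost + W ≤ 2 n W.  Remove a vertex of least
-- weighted degree again and again.  The vertex removed from a rest of k vertices
-- carries at most a fraction 2 / k of the weight of that rest, and induction
-- bounds the sum of weight times the size of what is left (cheapOrder).  Put the
-- vertices back in reverse order, each time merging the new vertex with the
-- components adjacent to it (grow).  All clusters are connected, so their
-- diameter is below their size and the hierarchy is feasible; and every edge is
-- inside one tree as soon as both its ends are present, so its height is at most
-- the number of vertices present before its later end (LowEdges).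
--
-- In the complete graph the estimate is an equality for every hierarchy, by
-- induction on the tree (heights-pairs), and the constant 1 shows OPTfree ≤ W.

open import Defs
open import Data.Nat.Base using (ℕ) renaming (_≤_ to _≤ℕ_)
open import Data.Product.Base using (_×_; ∃-syntax)
import Algebra.Construct.NaturalChoice.Max as Max
import Algebra.Properties.Ring as RingProperties
open import Data.Bool.Base using (false; true; if_then_else_)
open import Data.Bool.Properties using (∧-comm)
open import Data.Empty using (⊥-elim)
open import Data.Fin.Base using (Fin; zero; suc)
open import Data.Fin.Properties using (_≟_; all?; <-cmp) renaming (_<?_ to _<ᶠ?_)
open import Data.List.Base
  using (List; []; _∷_; _++_; length; map; filter; allFin; concatMap; cartesianProduct; cartesianProductWith)
open import Data.List.Properties using (length-++; length-tabulate; ++-assoc; ++-identityʳ)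
import Data.List.Extrema
open import Data.List.Extrema.Nat using (max; xs≤max; argmax-all)
import Data.List.Membership.DecPropositional as DecMembership
open import Data.List.Membership.Propositional using (_∈_; _∉_; find; lose)
open import Data.List.Membership.Propositional.Properties
  using ( ∈-++⁺ˡ; ∈-++⁺ʳ; ∈-++⁻; ∈-∃++; ∈-map⁺; ∈-allFin; ∈-filter⁺; ∈-filter⁻; ∈-concatMap⁺; ∈-concatMap⁻
        ; ∈-cartesianProduct⁺; ∈-cartesianProductWith⁺; ∈-cartesianProductWith⁻ )
open import Data.List.Relation.Binary.Permutation.Propositional
  using (_↭_; refl; prep; swap; trans; ↭⇒↭ₛ; ↭-sym; ↭-trans; ↭-refl; ↭-reflexive; module PermutationReasoning)
open import Data.List.Relation.Binary.Permutation.Propositional.Properties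
  using (∈-resp-↭; ↭-length; shift; shifts; ++⁺ˡ; ++⁺ʳ; drop-∷; ¬x∷xs↭[])
import Data.List.Relation.Binary.Permutation.Setoid.Properties as Permutationₛ
open import Data.List.Relation.Unary.All as All using (All; []; _∷_)
import Data.List.Relation.Unary.All.Properties as All
open import Data.List.Relation.Unary.AllPairs as AllPairs using (AllPairs; []; _∷_)
open import Data.List.Relation.Unary.Any as Any using (here; there)
open import Data.List.Relation.Unary.Unique.Propositional using (Unique)
open import Data.List.Relation.Unary.Unique.Propositional.Properties using (allFin⁺)
open import Data.Nat.Base using (zero; suc; _∸_; z≤n; s≤s; s≤s⁻¹) renaming (_+_ to _+ℕ_)
import Data.Nat.Properties as ℕ
open import Data.Product.Base using (_,_; proj₁; proj₂)
open import Data.Sum.Base as Sum using (_⊎_; inj₁; inj₂; [_,_]′)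
open import Data.Tree.Binary using (Tree; leaf; node; module Leaves)
open import Data.Unit.Base using (⊤; tt)
open import Function.Base using (_∘_; id)
open import Function.Metric.Structures using (IsGeneralMetric)
open import Relation.Binary.Bundles using (DecTotalOrder)
open import Relation.Binary.Definitions using (DecidableEquality; tri<; tri≈; tri>)
import Relation.Binary.Properties.TotalOrder as TotalOrderProperties
open import Relation.Binary.PropositionalEquality using (_≡_; _≢_; refl; sym; cong; subst; module ≡-Reasoning)
import Relation.Binary.PropositionalEquality as ≡
open import Relation.Nullary.Decidable using (Dec; yes; no; does; dec-true; dec-false; map′; ¬?; _×-dec_)
open import Relation.Nullary.Negation using (¬_)
open import Relation.Unary using (Decidable)

-- Lists up to permutation

module _ {A : Set} where

  Unique-resp-↭ : {xs ys : List A} → xs ↭ ys → Unique xs → Unique ys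
  Unique-resp-↭ p =
    Permutationₛ.AllPairs-resp-↭ (≡.setoid A) ≡.≢-sym (≡.resp₂ _≢_) (↭⇒↭ₛ p)

  Unique-++⁻ : ∀ xs {ys : List A} → Unique (xs ++ ys) →
               Unique xs × Unique ys × (∀ {x} → x ∈ xs → x ∉ ys)
  Unique-++⁻ []       u        = [] , u , λ ()
  Unique-++⁻ (x ∷ xs) (x∉ ∷ u) with Unique-++⁻ xs u
  ... | uxs , uys , disjoint =
    All.++⁻ˡ xs x∉ ∷ uxs , uys ,
    λ { (here refl) x∈ys → All.lookup (All.++⁻ʳ xs x∉) x∈ys refl
      ; (there x∈xs)     → disjoint x∈xs }

  extract : {x : A} {xs : List A} → x ∈ xs → ∃[ ys ] xs ↭ x ∷ ys
  extract {x} x∈xs with ∈-∃++ x∈xs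
  ... | as , bs , refl = as ++ bs , shift x as bs

module _ {A : Set} (_≟ᴬ_ : DecidableEquality A) where
  open DecMembership _≟ᴬ_ using (_∈?_)

  infix 4 _↭?_
  _↭?_ : (xs ys : List A) → Dec (xs ↭ ys)
  []     ↭? []       = yes ↭-refl
  []     ↭? (y ∷ ys) = no (¬x∷xs↭[] ∘ ↭-sym)
  (x ∷ xs) ↭? ys with x ∈? ys
  ... | no x∉ys = no λ p → x∉ys (∈-resp-↭ p (here refl))
  ... | yes x∈ys with extract x∈ys
  ...   | zs , q = map′ (λ p → ↭-trans (prep x p) (↭-sym q))
                        (λ p → drop-∷ (↭-trans p q)) (xs ↭? zs)

-- Hierarchies, lowest common ancestors and the ultrametrics they carry

VTree : ℕ → Set
VTree n = Tree ⊤ (Fin n)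

infix 4 _∈ᵗ_ _∉ᵗ_
_∈ᵗ_ _∉ᵗ_ : ∀ {n} → Fin n → VTree n → Set
x ∈ᵗ t = x ∈ cluster t
x ∉ᵗ t = x ∉ cluster t

module _ {n : ℕ} where
  open DecMembership (_≟_ {n}) using (_∈?_)

  -- Clusters are computed through difference lists; this is what makes the
  -- cluster of a node the concatenation of the clusters of its children.
  diffList-++ : ∀ (t : VTree n) ys → Leaves.toDiffList t ys ≡ cluster t ++ ys
  diffList-++ (leaf x)     ys = refl
  diffList-++ (node l _ r) ys = begin
    Leaves.toDiffList l (Leaves.toDiffList r ys) ≡⟨ diffList-++ l _ ⟩
    cluster l ++ Leaves.toDiffList r ys          ≡⟨ cong (cluster l ++_) (diffList-++ r ys) ⟩
    cluster l ++ (cluster r ++ ys)               ≡⟨ ++-assoc (cluster l) _ _ ⟨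
    (cluster l ++ cluster r) ++ ys               ≡⟨ cong (_++ ys) (diffList-++ l _) ⟨
    Leaves.toDiffList l (cluster r) ++ ys        ∎
    where
    open ≡-Reasoning

  cluster-node : ∀ l r → cluster (node l tt r) ≡ cluster l ++ cluster r
  cluster-node l r = diffList-++ l (cluster r)

  ∈-node⁻ : ∀ {l r x} → x ∈ᵗ node l tt r → x ∈ᵗ l ⊎ x ∈ᵗ r
  ∈-node⁻ {l} {r} x∈ = ∈-++⁻ (cluster l) (subst (_ ∈_) (cluster-node l r) x∈)

  ∈-nodeˡ : ∀ {l r x} → x ∈ᵗ l → x ∈ᵗ node l tt r
  ∈-nodeˡ {l} {r} x∈ = subst (_ ∈_) (sym (cluster-node l r)) (∈-++⁺ˡ x∈)

  ∈-nodeʳ : ∀ {l r x} → x ∈ᵗ r → x ∈ᵗ node l tt r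
  ∈-nodeʳ {l} {r} x∈ = subst (_ ∈_) (sym (cluster-node l r)) (∈-++⁺ʳ (cluster l) x∈)

  size : VTree n → ℕ
  size t = length (cluster t)

  size-node : ∀ l r → size (node l tt r) ≡ size l +ℕ size r
  size-node l r = ≡.trans (cong length (cluster-node l r)) (length-++ (cluster l))

  someLeaf : ∀ t → ∃[ x ] x ∈ᵗ t
  someLeaf (leaf x)     = x , here refl
  someLeaf (node l _ r) with someLeaf l
  ... | x , x∈l = x , ∈-nodeˡ {l} {r} x∈l

  1≤size : ∀ t → 1 ≤ℕ size t
  1≤size (leaf x)     = s≤s z≤n
  1≤size (node l _ r) = ℕ.≤-trans (1≤size l)
    (ℕ.≤-trans (ℕ.m≤m+n (size l) (size r)) (ℕ.≤-reflexive (sym (size-node l r))))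

  -- The recursive form of having no repeated leaf, which is what descending
  -- into a child needs.
  Distinct : VTree n → Set
  Distinct (leaf _)     = ⊤
  Distinct (node l _ r) = Distinct l × Distinct r × (∀ {x} → x ∈ᵗ l → x ∉ᵗ r)

  distinct : ∀ t → Unique (cluster t) → Distinct t
  distinct (leaf _)     _ = tt
  distinct (node l _ r) u with Unique-++⁻ (cluster l) (subst Unique (cluster-node l r) u)
  ... | ul , ur , disjoint = distinct l ul , distinct r ur , disjoint

  Spans : VTree n → Set
  Spans t = cluster t ↭ allFin n

  spans-∈ : ∀ t → Spans t → ∀ x → x ∈ᵗ t
  spans-∈ t t↭ x = ∈-resp-↭ (↭-sym t↭) (∈-allFin x)

  spans-distinct : ∀ t → Spans t → Distinct t
  spans-distinct t t↭ = distinct t (Unique-resp-↭ (↭-sym t↭) (allFin⁺ n))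

  spans-size : ∀ t → Spans t → size t ≡ n
  spans-size t t↭ = ≡.trans (↭-length t↭) (length-tabulate id)

  lca-left : ∀ l r {x y} → x ∈ᵗ l → y ∈ᵗ l → lca (node l tt r) x y ≡ lca l x y
  lca-left l r {x} {y} x∈l y∈l
    rewrite dec-true (x ∈? cluster l) x∈l | dec-true (y ∈? cluster l) y∈l = refl

  lca-right : ∀ l r {x y} → x ∉ᵗ l → x ∈ᵗ r → y ∈ᵗ r → lca (node l tt r) x y ≡ lca r x y
  lca-right l r {x} {y} x∉l x∈r y∈r
    rewrite dec-false (x ∈? cluster l) x∉l | dec-true (x ∈? cluster r) x∈r
          | dec-true (y ∈? cluster r) y∈r = refl

  lca-split : ∀ l r {x y} → x ∉ᵗ r → y ∉ᵗ l → lca (node l tt r) x y ≡ node l tt r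
  lca-split l r {x} {y} x∉r y∉l
    rewrite dec-false (x ∈? cluster r) x∉r | dec-false (y ∈? cluster l) y∉l
          | ∧-comm (does (x ∈? cluster l)) false = refl

  lca-comm : ∀ t x y → lca t x y ≡ lca t y x
  lca-comm (leaf _)     x y = refl
  lca-comm (node l _ r) x y
    rewrite ∧-comm (does (x ∈? cluster l)) (does (y ∈? cluster l))
          | ∧-comm (does (x ∈? cluster r)) (does (y ∈? cluster r))
          | lca-comm l x y | lca-comm r x y = refl

  -- Either both leaves lie on the same side and the search for their lowest
  -- common ancestor continues there, or the node separates them and the search
  -- stops.
  data Position (l r : VTree n) (x y : Fin n) : Set where
    left  : x ∈ᵗ l → y ∈ᵗ l → lca (node l tt r) x y ≡ lca l x y → Position l r x y
    right : x ∈ᵗ r → y ∈ᵗ r → lca (node l tt r) x y ≡ lca r x y → Position l r x y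
    split : (x ∈ᵗ l × y ∈ᵗ r) ⊎ (x ∈ᵗ r × y ∈ᵗ l) → lca (node l tt r) x y ≡ node l tt r →
            Position l r x y

  position : ∀ l r → Distinct (node l tt r) → ∀ {x y} → x ∈ᵗ node l tt r → y ∈ᵗ node l tt r →
             Position l r x y
  position l r (_ , _ , disjoint) x∈ y∈ with ∈-node⁻ {l} {r} x∈ | ∈-node⁻ {l} {r} y∈
  ... | inj₁ x∈l | inj₁ y∈l = left x∈l y∈l (lca-left l r x∈l y∈l)
  ... | inj₂ x∈r | inj₂ y∈r = right x∈r y∈r (lca-right l r (λ x∈l → disjoint x∈l x∈r) x∈r y∈r)
  ... | inj₁ x∈l | inj₂ y∈r = split (inj₁ (x∈l , y∈r))
    (lca-split l r (disjoint x∈l) (λ y∈l → disjoint y∈l y∈r))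
  ... | inj₂ x∈r | inj₁ y∈l = split (inj₂ (x∈r , y∈l))
    (≡.trans (lca-comm (node l tt r) _ _)
             (lca-split l r (disjoint y∈l) (λ x∈l → disjoint x∈l x∈r)))

  -- The lowest common ancestor is a subtree, so it inherits every property that
  -- passes from a node to its children.
  module _ (P : VTree n → Set) where
    lca-induction : ∀ t → Distinct t → ∀ {x y} → x ∈ᵗ t → y ∈ᵗ t → P t →
                    (∀ {l r} → P (node l tt r) → P l × P r) → P (lca t x y)
    lca-induction (leaf _)     d x∈ y∈ p down = p
    lca-induction (node l _ r) d@(dl , dr , _) x∈ y∈ p down with position l r d x∈ y∈
    ... | left  x∈l y∈l eq = subst P (sym eq) (lca-induction l dl x∈l y∈l (proj₁ (down p)) down)
    ... | right x∈r y∈r eq = subst P (sym eq) (lca-induction r dr x∈r y∈r (proj₂ (down p)) down)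
    ... | split _ eq       = subst P (sym eq) p

  lca-∋ : ∀ t → Distinct t → ∀ {x y} → x ∈ᵗ t → y ∈ᵗ t → x ∈ᵗ lca t x y × y ∈ᵗ lca t x y
  lca-∋ (leaf _)     d x∈ y∈ = x∈ , y∈
  lca-∋ (node l _ r) d@(dl , dr , _) x∈ y∈ with position l r d x∈ y∈
  ... | left  x∈l y∈l eq rewrite eq = lca-∋ l dl x∈l y∈l
  ... | right x∈r y∈r eq rewrite eq = lca-∋ r dr x∈r y∈r
  ... | split _ eq       rewrite eq = x∈ , y∈

  Monotone : (VTree n → ℕ) → Set
  Monotone g = ∀ l r → g l ≤ℕ g (node l tt r) × g r ≤ℕ g (node l tt r)

  -- For g = rank below, this is the cardinality height of the hierarchy.
  treeMetric : (VTree n → ℕ) → VTree n → Fin n → Fin n → ℕ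
  treeMetric g t x y = if does (x ≟ y) then 0 else g (lca t x y)

  treeMetric-refl : ∀ g t x → treeMetric g t x x ≡ 0
  treeMetric-refl g t x rewrite dec-true (x ≟ x) refl = refl

  treeMetric-≢ : ∀ g t {x y} → x ≢ y → treeMetric g t x y ≡ g (lca t x y)
  treeMetric-≢ g t {x} {y} x≢y rewrite dec-false (x ≟ y) x≢y = refl

  treeMetric-sym : ∀ g t x y → treeMetric g t x y ≡ treeMetric g t y x
  treeMetric-sym g t x y with x ≟ y
  ... | yes refl = sym (treeMetric-refl g t x)
  ... | no x≢y   = ≡.trans (cong g (lca-comm t x y)) (sym (treeMetric-≢ g t (x≢y ∘ sym)))

  treeMetric-≤ : ∀ g t x y → treeMetric g t x y ≤ℕ g (lca t x y)
  treeMetric-≤ g t x y with x ≟ y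
  ... | yes _ = z≤n
  ... | no _  = ℕ.≤-refl

  module _ {g : VTree n → ℕ} (mono : Monotone g) where
    lca-≤ : ∀ t → Distinct t → ∀ {x y} → x ∈ᵗ t → y ∈ᵗ t → g (lca t x y) ≤ℕ g t
    lca-≤ t d x∈ y∈ = lca-induction (λ s → g s ≤ℕ g t) t d x∈ y∈ ℕ.≤-refl
      (λ {l} {r} p → ℕ.≤-trans (proj₁ (mono l r)) p , ℕ.≤-trans (proj₂ (mono l r)) p)

    -- If some node separates x from y or y from z, then the first such node is
    -- an ancestor of all three, and g is largest there; otherwise the three
    -- leaves descend together.
    lca-ultra : ∀ t → Distinct t → ∀ {x y z} → x ∈ᵗ t → y ∈ᵗ t → z ∈ᵗ t →
                g (lca t x z) ≤ℕ g (lca t x y) ⊎ g (lca t x z) ≤ℕ g (lca t y z)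
    lca-ultra (leaf _) d x∈ y∈ z∈ = inj₁ ℕ.≤-refl
    lca-ultra t@(node l _ r) d@(dl , dr , disjoint) x∈ y∈ z∈
      with position l r d x∈ y∈ | position l r d y∈ z∈
    ... | split _ xy | _          rewrite xy = inj₁ (lca-≤ t d x∈ z∈)
    ... | _          | split _ yz rewrite yz = inj₂ (lca-≤ t d x∈ z∈)
    ... | left x∈l y∈l xy | left _ z∈l yz
      rewrite xy | yz | lca-left l r x∈l z∈l = lca-ultra l dl x∈l y∈l z∈l
    ... | right x∈r y∈r xy | right _ z∈r yz
      rewrite xy | yz | lca-right l r (λ x∈l → disjoint x∈l x∈r) x∈r z∈r =
        lca-ultra r dr x∈r y∈r z∈r
    ... | left _ y∈l _  | right y∈r _ _ = ⊥-elim (disjoint y∈l y∈r)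
    ... | right _ y∈r _ | left y∈l _ _  = ⊥-elim (disjoint y∈l y∈r)

    treeMetric-ultra : ∀ t → Spans t → ∀ x y z →
      treeMetric g t x z ≤ℕ treeMetric g t x y ⊎ treeMetric g t x z ≤ℕ treeMetric g t y z
    treeMetric-ultra t t↭ x y z with x ≟ y
    ... | yes refl = inj₂ ℕ.≤-refl
    ... | no _ with y ≟ z
    ...   | yes refl = inj₁ (treeMetric-≤ g t x z)
    ...   | no _     = Sum.map (ℕ.≤-trans (treeMetric-≤ g t x z)) (ℕ.≤-trans (treeMetric-≤ g t x z))
        (lca-ultra t (spans-distinct t t↭) (spans-∈ t t↭ x) (spans-∈ t t↭ y) (spans-∈ t t↭ z))

  rank : VTree n → ℕ
  rank t = size t ∸ 1

  rank-mono : Monotone rank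
  rank-mono l r rewrite size-node l r =
    ℕ.∸-monoˡ-≤ 1 (ℕ.m≤m+n (size l) (size r)) , ℕ.∸-monoˡ-≤ 1 (ℕ.m≤n+m (size r) (size l))

  rank-node : ∀ l r → rank (node l tt r) ≡ suc (rank l +ℕ rank r)
  rank-node l r rewrite size-node l r with size l | size r | 1≤size l | 1≤size r
  ... | suc p | suc q | _ | _ = ℕ.+-suc p q

  rank-pos : ∀ t {x y} → x ≢ y → x ∈ᵗ t → y ∈ᵗ t → 1 ≤ℕ rank t
  rank-pos (leaf _)     x≢y (here refl) (here refl) = ⊥-elim (x≢y refl)
  rank-pos (node l _ r) _   _           _           rewrite rank-node l r = s≤s z≤n

  -- Only finitely many trees have at most k leaves, so a minimum over
  -- hierarchies is a minimum over a list.
  treesUpTo : ℕ → List (VTree n)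
  treesUpTo zero    = []
  treesUpTo (suc k) = map leaf (allFin n) ++
    cartesianProductWith (λ l r → node l tt r) (treesUpTo k) (treesUpTo k)

  treesUpTo-complete : ∀ k t → size t ≤ℕ k → t ∈ treesUpTo k
  treesUpTo-complete (suc k) (leaf x)     _ = ∈-++⁺ˡ (∈-map⁺ leaf (∈-allFin x))
  treesUpTo-complete zero    t            le with size t | 1≤size t
  treesUpTo-complete zero    t            () | suc _ | _
  treesUpTo-complete (suc k) (node l _ r) le = ∈-++⁺ʳ (map leaf (allFin n))
    (∈-cartesianProductWith⁺ (λ l r → node l tt r)
      (treesUpTo-complete k l (s≤s⁻¹ (ℕ.<-≤-trans (ℕ.m<m+n (size l) (1≤size r)) le′)))
      (treesUpTo-complete k r (s≤s⁻¹ (ℕ.<-≤-trans (ℕ.m<n+m (size r) (1≤size l)) le′))))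
    where
    le′ : size l +ℕ size r ≤ℕ suc k
    le′ = ℕ.≤-trans (ℕ.≤-reflexive (sym (size-node l r))) le

-- Ordered-field arithmetic and finite sums

module Reals (ℝ : RealNumbers) where
  open RealNumbers ℝ

  decTotalOrder : DecTotalOrder _ _ _
  decTotalOrder = record { isDecTotalOrder = isDecTotalOrder }

  open import Relation.Binary.Reasoning.PartialOrder (DecTotalOrder.poset decTotalOrder) public
  open import Algebra.Solver.Ring.NaturalCoefficients.Default R.commutativeSemiring public
    using (solve; _:=_; _:+_; _:*_; con)

  +-mono-≤ : ∀ {a b c d} → a ≤ b → c ≤ d → a + c ≤ b + d
  +-mono-≤ {a} {b} {c} {d} a≤b c≤d = begin
    a + c ≤⟨ +-monoˡ-≤ c a≤b ⟩
    b + c ≈⟨ R.+-comm b c ⟩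
    c + b ≤⟨ +-monoˡ-≤ b c≤d ⟩
    d + b ≈⟨ R.+-comm d b ⟩
    b + d ∎

  +-cancelʳ-≤ : ∀ c {a b} → a + c ≤ b + c → a ≤ b
  +-cancelʳ-≤ c {a} {b} le = begin
    a             ≈⟨ cancel a ⟨
    a + c + (- c) ≤⟨ +-monoˡ-≤ (- c) le ⟩
    b + c + (- c) ≈⟨ cancel b ⟩
    b             ∎
    where
    cancel : ∀ a → a + c + (- c) ≈ a
    cancel a = R.trans (R.+-assoc a c (- c))
      (R.trans (R.+-congˡ (R.-‿inverseʳ c)) (R.+-identityʳ a))

  -- Costs over undirected edges are compared through sums over ordered pairs,
  -- which count every edge twice.
  double-cancel-≤ : ∀ {a b} → a + a ≤ b + b → a ≤ b
  double-cancel-≤ {a} {b} le with O.total a b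
  ... | inj₁ a≤b = a≤b
  ... | inj₂ b≤a = +-cancelʳ-≤ a (O.trans le (+-mono-≤ O.refl b≤a))

  *-monoʳ-≤ : ∀ {a b c} → 0# ≤ c → a ≤ b → c * a ≤ c * b
  *-monoʳ-≤ {a} {b} {c} 0≤c a≤b = +-cancelʳ-≤ (c * (- a)) (begin
    c * a + c * (- a) ≈⟨ R.distribˡ c a (- a) ⟨
    c * (a - a)       ≈⟨ R.*-congˡ (R.-‿inverseʳ a) ⟩
    c * 0#            ≈⟨ R.zeroʳ c ⟩
    0#                ≤⟨ *-nonNegative 0≤c 0≤b-a ⟩
    c * (b - a)       ≈⟨ R.distribˡ c b (- a) ⟩
    c * b + c * (- a) ∎)
    where
    0≤b-a : 0# ≤ b - a
    0≤b-a = O.≤-respˡ-≈ (R.-‿inverseʳ a) (+-monoˡ-≤ (- a) a≤b)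

  *-monoˡ-≤ : ∀ {a b c} → 0# ≤ c → a ≤ b → a * c ≤ b * c
  *-monoˡ-≤ {a} {b} {c} 0≤c a≤b = begin
    a * c ≈⟨ R.*-comm a c ⟩
    c * a ≤⟨ *-monoʳ-≤ 0≤c a≤b ⟩
    c * b ≈⟨ R.*-comm c b ⟩
    b * c ∎

  x≤x+y : ∀ {x y} → 0# ≤ y → x ≤ x + y
  x≤x+y {x} 0≤y = O.≤-respˡ-≈ (R.+-identityʳ x) (+-mono-≤ O.refl 0≤y)

  inv-nonNegative : ∀ {x} → 0# ≤ x → (x≉0 : ¬ x ≈ 0#) → 0# ≤ inv x x≉0
  inv-nonNegative {x} 0≤x x≉0 with O.total 0# (inv x x≉0)
  ... | inj₁ 0≤x⁻¹ = 0≤x⁻¹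
  ... | inj₂ x⁻¹≤0 = ⊥-elim (0≉1 (O.antisym 0≤1 (begin
    1#            ≈⟨ *-inv x x≉0 ⟨
    x * inv x x≉0 ≤⟨ *-monoʳ-≤ 0≤x x⁻¹≤0 ⟩
    x * 0#        ≈⟨ R.zeroʳ x ⟩
    0#            ∎)))

  /-≤ : ∀ {a b c} → 0# ≤ b → (b≉0 : ¬ b ≈ 0#) → a ≤ c * b → a / b [ b≉0 ] ≤ c
  /-≤ {a} {b} {c} 0≤b b≉0 a≤cb = begin
    a * b⁻¹       ≤⟨ *-monoˡ-≤ (inv-nonNegative 0≤b b≉0) a≤cb ⟩
    c * b * b⁻¹   ≈⟨ R.*-assoc c b b⁻¹ ⟩
    c * (b * b⁻¹) ≈⟨ R.*-congˡ (*-inv b b≉0) ⟩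
    c * 1#        ≈⟨ R.*-identityʳ c ⟩
    c             ∎
    where b⁻¹ = inv b b≉0

  ≤-/ : ∀ {a b c} → 0# ≤ b → (b≉0 : ¬ b ≈ 0#) → c * b ≤ a → c ≤ a / b [ b≉0 ]
  ≤-/ {a} {b} {c} 0≤b b≉0 cb≤a = begin
    c             ≈⟨ R.*-identityʳ c ⟨
    c * 1#        ≈⟨ R.*-congˡ (*-inv b b≉0) ⟨
    c * (b * b⁻¹) ≈⟨ R.*-assoc c b b⁻¹ ⟨
    c * b * b⁻¹   ≤⟨ *-monoˡ-≤ (inv-nonNegative 0≤b b≉0) cb≤a ⟩
    a * b⁻¹       ∎
    where b⁻¹ = inv b b≉0

  fromℕ-nonNegative : ∀ m → 0# ≤ fromℕ m
  fromℕ-nonNegative zero    = O.refl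
  fromℕ-nonNegative (suc m) = O.trans 0≤1 (1≤fromℕ-suc m)

  1≤fromℕ : ∀ {k} → Fin k → 1# ≤ fromℕ k
  1≤fromℕ {suc k} _ = 1≤fromℕ-suc k

  fromℕ-mono-≤ : ∀ {m k} → m ≤ℕ k → fromℕ m ≤ fromℕ k
  fromℕ-mono-≤ {k = k} z≤n = fromℕ-nonNegative k
  fromℕ-mono-≤ (s≤s m≤k)   = +-mono-≤ O.refl (fromℕ-mono-≤ m≤k)

  fromℕ-+ : ∀ m k → fromℕ (m +ℕ k) ≈ fromℕ m + fromℕ k
  fromℕ-+ zero    k = R.sym (R.+-identityˡ _)
  fromℕ-+ (suc m) k = R.trans (R.+-congˡ (fromℕ-+ m k)) (R.sym (R.+-assoc 1# _ _))

  fromℕ≈0⇒≡0 : ∀ m → fromℕ m ≈ 0# → m ≡ 0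
  fromℕ≈0⇒≡0 zero    _  = refl
  fromℕ≈0⇒≡0 (suc m) eq = ⊥-elim (fromℕ-suc≉0 m eq)

  minus-one : ∀ N W → (N - 1#) * W + W ≈ N * W
  minus-one N W = begin-equality
    (N - 1#) * W + W      ≈⟨ R.+-congˡ (R.*-identityˡ W) ⟨
    (N - 1#) * W + 1# * W ≈⟨ R.distribʳ W (N - 1#) 1# ⟨
    ((N - 1#) + 1#) * W   ≈⟨ R.*-congʳ (R.trans (R.+-assoc N (- 1#) 1#)
                               (R.trans (R.+-congˡ (R.-‿inverseˡ 1#)) (R.+-identityʳ N))) ⟩
    N * W                 ∎

  third : Carrier → Carrier
  third x = x / fromℕ 3 [ fromℕ-suc≉0 2 ]

  third-* : ∀ x b → third (x * b) ≈ third x * b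
  third-* x b = solve 3 (λ x b i → x :* b :* i := x :* i :* b) R.refl x b _

  -- With 3a + W on one side, both cost estimates avoid subtraction; these two
  -- lemmas turn them into bounds on a, replacing W by b on the way.
  ≤-third : ∀ {N a b W} → 0# ≤ N - 1# → W ≤ b → fromℕ 3 * a + W ≤ N * W →
            a ≤ third (N - 1#) * b
  ≤-third {N} {a} {b} {W} 0≤N-1 W≤b bound =
    O.≤-respʳ-≈ (third-* (N - 1#) b) (≤-/ (fromℕ-nonNegative 3) _ (begin
      a * fromℕ 3   ≤⟨ +-cancelʳ-≤ W (begin
        a * fromℕ 3 + W ≈⟨ R.+-congʳ (R.*-comm a _) ⟩
        fromℕ 3 * a + W ≤⟨ bound ⟩
        N * W           ≈⟨ minus-one N W ⟨
        (N - 1#) * W + W ∎) ⟩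
      (N - 1#) * W  ≤⟨ *-monoʳ-≤ 0≤N-1 W≤b ⟩
      (N - 1#) * b  ∎))

  third-≤ : ∀ {N a b W} → 0# ≤ N - 1# → b ≤ W → N * W ≤ fromℕ 3 * a + W →
            third (N - 1#) * b ≤ a
  third-≤ {N} {a} {b} {W} 0≤N-1 b≤W bound =
    O.≤-respˡ-≈ (third-* (N - 1#) b) (/-≤ (fromℕ-nonNegative 3) _ (begin
      (N - 1#) * b  ≤⟨ *-monoʳ-≤ 0≤N-1 b≤W ⟩
      (N - 1#) * W  ≤⟨ +-cancelʳ-≤ W (begin
        (N - 1#) * W + W ≈⟨ minus-one N W ⟩
        N * W            ≤⟨ bound ⟩
        fromℕ 3 * a + W  ≈⟨ R.+-congʳ (R.*-comm _ a) ⟩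
        a * fromℕ 3 + W  ∎) ⟩
      a * fromℕ 3   ∎))

  module _ {A : Set} where
    ∑ : List A → (A → Carrier) → Carrier
    ∑ xs f = sum (map f xs)

    ∑-cong : ∀ xs {f g} → (∀ {x} → x ∈ xs → f x ≈ g x) → ∑ xs f ≈ ∑ xs g
    ∑-cong []       eq = R.refl
    ∑-cong (x ∷ xs) eq = R.+-cong (eq (here refl)) (∑-cong xs (eq ∘ there))

    ∑-mono : ∀ xs {f g} → (∀ {x} → x ∈ xs → f x ≤ g x) → ∑ xs f ≤ ∑ xs g
    ∑-mono []       le = O.refl
    ∑-mono (x ∷ xs) le = +-mono-≤ (le (here refl)) (∑-mono xs (le ∘ there))

    ∑-nonNegative : ∀ xs {f} → (∀ {x} → x ∈ xs → 0# ≤ f x) → 0# ≤ ∑ xs f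
    ∑-nonNegative []       0≤f = O.refl
    ∑-nonNegative (x ∷ xs) 0≤f =
      O.trans (0≤f (here refl)) (x≤x+y (∑-nonNegative xs (0≤f ∘ there)))

    ∑-member : ∀ xs {f} → (∀ {x} → x ∈ xs → 0# ≤ f x) → ∀ {x} → x ∈ xs → f x ≤ ∑ xs f
    ∑-member (x ∷ xs) 0≤f (here refl) = x≤x+y (∑-nonNegative xs (0≤f ∘ there))
    ∑-member (x ∷ xs) 0≤f (there y∈)  = O.trans (∑-member xs (0≤f ∘ there) y∈)
      (O.≤-respʳ-≈ (R.+-comm _ _) (x≤x+y (0≤f (here refl))))

    ∑-++ : ∀ xs ys f → ∑ (xs ++ ys) f ≈ ∑ xs f + ∑ ys f
    ∑-++ []       ys f = R.sym (R.+-identityˡ _)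
    ∑-++ (x ∷ xs) ys f = R.trans (R.+-congˡ (∑-++ xs ys f)) (R.sym (R.+-assoc _ _ _))

    ∑-+ : ∀ xs f g → ∑ xs (λ x → f x + g x) ≈ ∑ xs f + ∑ xs g
    ∑-+ []       f g = R.sym (R.+-identityˡ _)
    ∑-+ (x ∷ xs) f g = R.trans (R.+-congˡ (∑-+ xs f g))
      (solve 4 (λ a b c d → (a :+ b) :+ (c :+ d) := (a :+ c) :+ (b :+ d)) R.refl _ _ _ _)

    ∑-const : ∀ xs c → ∑ xs (λ _ → c) ≈ fromℕ (length xs) * c
    ∑-const []       c = R.sym (R.zeroˡ c)
    ∑-const (x ∷ xs) c = R.trans (R.+-congˡ (∑-const xs c))
      (solve 2 (λ c k → c :+ k :* c := (con 1 :+ k) :* c) R.refl c _)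

    ∑-zero : ∀ xs → ∑ xs (λ _ → 0#) ≈ 0#
    ∑-zero xs = R.trans (∑-const xs 0#) (R.zeroʳ _)

    ∑-*ʳ : ∀ xs f c → ∑ xs (λ x → f x * c) ≈ ∑ xs f * c
    ∑-*ʳ []       f c = R.sym (R.zeroˡ c)
    ∑-*ʳ (x ∷ xs) f c = R.trans (R.+-congˡ (∑-*ʳ xs f c)) (R.sym (R.distribʳ c _ _))

    ∑-↭ : ∀ {xs ys} f → xs ↭ ys → ∑ xs f ≈ ∑ ys f
    ∑-↭ f refl         = R.refl
    ∑-↭ f (prep x p)   = R.+-congˡ (∑-↭ f p)
    ∑-↭ f (swap x y p) = R.trans (R.+-congˡ (R.+-congˡ (∑-↭ f p)))
      (solve 3 (λ a b c → a :+ (b :+ c) := b :+ (a :+ c)) R.refl _ _ _)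
    ∑-↭ f (trans p q)  = R.trans (∑-↭ f p) (∑-↭ f q)

    ∑-filter : ∀ {P : A → Set} (P? : Decidable P) xs f →
               ∑ (filter P? xs) f ≈ ∑ xs (λ x → if does (P? x) then f x else 0#)
    ∑-filter P? []       f = R.refl
    ∑-filter P? (x ∷ xs) f with does (P? x)
    ... | true  = R.+-congˡ (∑-filter P? xs f)
    ... | false = R.trans (∑-filter P? xs f) (R.sym (R.+-identityˡ _))

  double-cancel-≈ : ∀ {a b} → a + a ≈ b + b → a ≈ b
  double-cancel-≈ eq = O.antisym (double-cancel-≤ (O.reflexive eq))
                                 (double-cancel-≤ (O.reflexive (R.sym eq)))

  module _ {A B : Set} where
    ∑-∑-const : ∀ (xs : List A) (ys : List B) {f : A → B → Carrier} c → (∀ {x y} → x ∈ xs → y ∈ ys → f x y ≈ c) →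
                ∑ xs (λ x → ∑ ys (f x)) ≈ fromℕ (length xs) * (fromℕ (length ys) * c)
    ∑-∑-const xs ys c eq = R.trans
      (∑-cong xs (λ x∈ → R.trans (∑-cong ys (eq x∈)) (∑-const ys c)))
      (∑-const xs _)

    ∑-map : ∀ (h : A → B) xs (f : B → Carrier) → ∑ (map h xs) f ≈ ∑ xs (f ∘ h)
    ∑-map h []       f = R.refl
    ∑-map h (x ∷ xs) f = R.+-congˡ (∑-map h xs f)

  module _ {A B : Set} where
    ∑-product : ∀ (xs : List A) (ys : List B) (f : A × B → Carrier) →
                ∑ (cartesianProduct xs ys) f ≈ ∑ xs (λ x → ∑ ys (λ y → f (x , y)))
    ∑-product []       ys f = R.refl
    ∑-product (x ∷ xs) ys f = R.trans (∑-++ (map (x ,_) ys) _ f)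
      (R.+-cong (∑-map (x ,_) ys f) (∑-product xs ys f))

    ∑-swap : ∀ (xs : List A) (ys : List B) (f : A → B → Carrier) →
             ∑ xs (λ x → ∑ ys (f x)) ≈ ∑ ys (λ y → ∑ xs (λ x → f x y))
    ∑-swap []       ys f = R.sym (∑-zero ys)
    ∑-swap (x ∷ xs) ys f = R.trans (R.+-congˡ (∑-swap xs ys f))
      (R.sym (∑-+ ys (f x) (λ y → ∑ xs (λ x → f x y))))

  module _ {A : Set} where
    ∑² : List A → (A → A → Carrier) → Carrier
    ∑² xs f = ∑ xs (λ x → ∑ xs (f x))

    ∑²-cong : ∀ xs {f g} → (∀ {x y} → x ∈ xs → y ∈ xs → f x y ≈ g x y) → ∑² xs f ≈ ∑² xs g
    ∑²-cong xs eq = ∑-cong xs (λ x∈ → ∑-cong xs (eq x∈))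

    ∑²-↭ : ∀ {xs ys} f → xs ↭ ys → ∑² xs f ≈ ∑² ys f
    ∑²-↭ {xs} {ys} f p = R.trans (∑-cong xs (λ {x} _ → ∑-↭ (f x) p)) (∑-↭ _ p)

    ∑²-++ : ∀ xs ys {f} → (∀ x y → f x y ≈ f y x) →
            ∑² (xs ++ ys) f ≈ (∑² xs f + ∑² ys f) + (∑ xs (λ x → ∑ ys (f x)) + ∑ xs (λ x → ∑ ys (f x)))
    ∑²-++ xs ys {f} f-sym = begin-equality
      ∑² (xs ++ ys) f
        ≈⟨ ∑-++ xs ys _ ⟩
      ∑ xs (λ x → ∑ (xs ++ ys) (f x)) + ∑ ys (λ y → ∑ (xs ++ ys) (f y))
        ≈⟨ R.+-cong (halves xs) (halves ys) ⟩
      (∑² xs f + ∑ xs (λ x → ∑ ys (f x))) + (∑ ys (λ y → ∑ xs (f y)) + ∑² ys f)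
        ≈⟨ R.+-congˡ (R.+-congʳ flipped) ⟩
      (∑² xs f + ∑ xs (λ x → ∑ ys (f x))) + (∑ xs (λ x → ∑ ys (f x)) + ∑² ys f)
        ≈⟨ solve 3 (λ a b c → (a :+ c) :+ (c :+ b) := (a :+ b) :+ (c :+ c)) R.refl _ _ _ ⟩
      (∑² xs f + ∑² ys f) + (∑ xs (λ x → ∑ ys (f x)) + ∑ xs (λ x → ∑ ys (f x))) ∎
      where
      halves : ∀ zs → ∑ zs (λ z → ∑ (xs ++ ys) (f z)) ≈
               ∑ zs (λ z → ∑ xs (f z)) + ∑ zs (λ z → ∑ ys (f z))
      halves zs = R.trans (∑-cong zs (λ {z} _ → ∑-++ xs ys (f z))) (∑-+ zs _ _)
      flipped : ∑ ys (λ y → ∑ xs (f y)) ≈ ∑ xs (λ x → ∑ ys (f x))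
      flipped = R.trans (∑-swap ys xs f)
        (∑-cong xs (λ {x} _ → ∑-cong ys (λ {y} _ → f-sym y x)))

    -- The effect of one more vertex v: the weight of its star counts twice.
    ∑²-∷ : ∀ v xs {f} → (∀ x y → f x y ≈ f y x) → f v v ≈ 0# →
           ∑² (v ∷ xs) f ≈ ∑² xs f + (∑ xs (f v) + ∑ xs (f v))
    ∑²-∷ v xs {f} f-sym fvv≈0 = begin-equality
      ∑² (v ∷ xs) f
        ≈⟨ ∑²-++ (v ∷ []) xs f-sym ⟩
      (((f v v + 0#) + 0#) + ∑² xs f) + ((∑ xs (f v) + 0#) + (∑ xs (f v) + 0#))
        ≈⟨ R.+-congʳ (R.+-congʳ (R.+-congʳ (R.+-congʳ fvv≈0))) ⟩
      (((0# + 0#) + 0#) + ∑² xs f) + ((∑ xs (f v) + 0#) + (∑ xs (f v) + 0#))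
        ≈⟨ solve 2 (λ a b → (((con 0 :+ con 0) :+ con 0) :+ a) :+ ((b :+ con 0) :+ (b :+ con 0)) := a :+ (b :+ b)) R.refl _ _ ⟩
      ∑² xs f + (∑ xs (f v) + ∑ xs (f v)) ∎

-- Growing a hierarchy with connected clusters along an arrival order

-- Lists are read as arrival orders with the last arrival in front: Joins L x y k
-- says that x arrives when exactly k vertices are present, y among them.
data Joins {A : Set} : List A → A → A → ℕ → Set where
  here  : ∀ {x y xs} → y ∈ xs → Joins (x ∷ xs) x y (length xs)
  there : ∀ {x y z xs k} → Joins xs x y k → Joins (z ∷ xs) x y k

joins-∈ : ∀ {A : Set} {xs : List A} {x y k} → Joins xs x y k → x ∈ xs × y ∈ xs
joins-∈ (here y∈xs) = here refl , there y∈xs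
joins-∈ (there j) with joins-∈ j
... | x∈ , y∈ = there x∈ , there y∈

module _ {n : ℕ} (G : ConnectedGraph n) where
  open ConnectedGraph G


  dist-≤ : ∀ {k x y} → Walk _~_ k x y → dist x y ≤ℕ k
  dist-≤ {k} {x} {y} p = proj₂ (proj₂ (shortestWalk x y)) k p

  dist-refl : ∀ x → dist x x ≡ 0
  dist-refl x = ℕ.n≤0⇒n≡0 (dist-≤ [])

  dist-pos : ∀ {x y} → x ≢ y → 1 ≤ℕ dist x y
  dist-pos {x} {y} x≢y with shortestWalk x y
  ... | zero  , [] , _ = ⊥-elim (x≢y refl)
  ... | suc _ , _  , _ = s≤s z≤n

  infixr 5 _++ʷ_
  _++ʷ_ : ∀ {k m x y z} → Walk _~_ k x y → Walk _~_ m y z → Walk _~_ (k +ℕ m) x z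
  []      ++ʷ q = q
  (e ∷ p) ++ʷ q = e ∷ (p ++ʷ q)

  -- Every node is held together by an edge between its two children, so all
  -- clusters induce connected subgraphs.
  Connected : VTree n → Set
  Connected (leaf _)     = ⊤
  Connected (node l _ r) =
    Connected l × Connected r × (∃[ x ] ∃[ y ] x ∈ᵗ l × y ∈ᵗ r × x ~ y)

  -- A walk inside a cluster uses one joining edge per node, hence at most one
  -- edge fewer than there are leaves.
  connected-walk : ∀ t → Connected t → ∀ {x y} → x ∈ᵗ t → y ∈ᵗ t → ∃[ k ] k ≤ℕ rank t × Walk _~_ k x y
  connected-walk (leaf _)     _ (here refl) (here refl) = 0 , z≤n , []
  connected-walk (node l _ r) (cl , cr , a , b , a∈l , b∈r , a~b) x∈ y∈
    with ∈-node⁻ {l = l} {r} x∈ | ∈-node⁻ {l = l} {r} y∈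
  ... | inj₁ x∈l | inj₁ y∈l with connected-walk l cl x∈l y∈l
  ...   | k , k≤ , p = k , ℕ.≤-trans k≤ (proj₁ (rank-mono l r)) , p
  connected-walk (node l _ r) (cl , cr , a , b , a∈l , b∈r , a~b) x∈ y∈
      | inj₂ x∈r | inj₂ y∈r with connected-walk r cr x∈r y∈r
  ...   | k , k≤ , p = k , ℕ.≤-trans k≤ (proj₂ (rank-mono l r)) , p
  connected-walk (node l _ r) (cl , cr , a , b , a∈l , b∈r , a~b) x∈ y∈
      | inj₁ x∈l | inj₂ y∈r
    with connected-walk l cl x∈l a∈l | connected-walk r cr b∈r y∈r
  ...   | k , k≤ , p | m , m≤ , q = k +ℕ suc m , bound , p ++ʷ a~b ∷ q
    where
    bound : k +ℕ suc m ≤ℕ rank (node l tt r)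
    bound rewrite rank-node l r | ℕ.+-suc k m = s≤s (ℕ.+-mono-≤ k≤ m≤)
  connected-walk (node l _ r) (cl , cr , a , b , a∈l , b∈r , a~b) x∈ y∈
      | inj₂ x∈r | inj₁ y∈l
    with connected-walk r cr x∈r b∈r | connected-walk l cl a∈l y∈l
  ...   | k , k≤ , p | m , m≤ , q = k +ℕ suc m , bound , p ++ʷ ~-sym a~b ∷ q
    where
    bound : k +ℕ suc m ≤ℕ rank (node l tt r)
    bound rewrite rank-node l r | ℕ.+-suc k m | ℕ.+-comm k m = s≤s (ℕ.+-mono-≤ m≤ k≤)

  connected⇒dist≤rank : ∀ t → Spans t → Connected t → ∀ x y → dist x y ≤ℕ treeMetric rank t x y
  connected⇒dist≤rank t t↭ c x y with x ≟ y
  ... | yes refl = ℕ.≤-reflexive (dist-refl x)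
  ... | no _ =
    let d       = spans-distinct t t↭
        x∈ , y∈ = spans-∈ t t↭ x , spans-∈ t t↭ y
        x∈s , y∈s = lca-∋ t d x∈ y∈
        cs        = lca-induction Connected t d x∈ y∈ c (λ { (cl , cr , _) → cl , cr })
        _ , k≤ , p = connected-walk (lca t x y) cs x∈s y∈s
    in ℕ.≤-trans (dist-≤ p) k≤

  -- The height of an edge is at most the number of vertices present before its
  -- later end arrives.
  LowEdges : List (Fin n) → VTree n → Set
  LowEdges L t = ∀ {x y k} → Joins L x y k → x ~ y → x ∈ᵗ t → y ∈ᵗ t → rank (lca t x y) ≤ℕ k

  Apart : VTree n → VTree n → Set
  Apart s t = ∀ {x y} → x ∈ᵗ s → y ∈ᵗ t → x ≢ y × ¬ x ~ y

  apart-sym : ∀ s t → Apart s t → Apart t s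
  apart-sym s t st x∈t y∈s = proj₁ (st y∈s x∈t) ∘ sym , proj₂ (st y∈s x∈t) ∘ ~-sym

  record Grown (L : List (Fin n)) (t : VTree n) : Set where
    field
      connectedᵗ : Connected t
      distinctᵗ  : Distinct t
      low        : LowEdges L t
  open Grown

  -- The trees are the connected components of the graph induced by the vertices
  -- that have arrived.
  record IsForest (L : List (Fin n)) (F : List (VTree n)) : Set where
    field
      grown  : All (Grown L) F
      apart  : AllPairs Apart F
      leaves : concatMap cluster F ↭ L

  -- The outcome of adding v to a forest F on L: one tree with v and all trees of
  -- F adjacent to v, and the untouched trees.  The bound low inside grown still
  -- refers to L, that is, to the edges that do not end in v.
  record Absorbed (v : Fin n) (L : List (Fin n)) (F : List (VTree n)) : Set where
    field
      tree   : VTree n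
      rest   : List (VTree n)
      v∈tree : v ∈ᵗ tree
      grown  : Grown L tree
      origin : ∀ {x} → x ∈ᵗ tree → x ≡ v ⊎ (∃[ t ] t ∈ F × x ∈ᵗ t)
      rest⊆  : ∀ {t} → t ∈ rest → t ∈ F
      apart  : AllPairs Apart (tree ∷ rest)
      leaves : concatMap cluster (tree ∷ rest) ↭ v ∷ concatMap cluster F

  -- Trees of F are apart, so a merge joins no old edge at the new node; old edges
  -- keep their lowest common ancestors.
  absorb : ∀ v L F → v ∉ L → All (v ∉ᵗ_) F → All (Grown L) F → AllPairs Apart F → Absorbed v L F
  absorb v L [] v∉L _ _ _ = record
    { tree   = leaf v
    ; rest   = []
    ; v∈tree = here refl
    ; grown  = record
      { connectedᵗ = tt
      ; distinctᵗ  = tt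
      ; low        = λ { j _ (here refl) _ → ⊥-elim (v∉L (proj₁ (joins-∈ j))) }
      }
    ; origin = λ { (here refl) → inj₁ refl }
    ; rest⊆  = λ ()
    ; apart  = [] ∷ []
    ; leaves = ↭-refl
    }
  absorb v L (t ∷ F) v∉L (v∉t ∷ v∉F) (gt ∷ gF) (tF ∷ FF)
    with absorb v L F v∉L v∉F gF FF | Any.any? (v ~?_) (cluster t)
  ... | a | yes v~t = record
    { tree   = node s tt t
    ; rest   = rest
    ; v∈tree = ∈-nodeˡ {l = s} {t} v∈tree
    ; grown  = record
      { connectedᵗ = connectedᵗ grown , connectedᵗ gt , joint
      ; distinctᵗ  = dst
      ; low        = low′
      }
    ; origin = origin′
    ; rest⊆  = there ∘ rest⊆
    ; apart  = All.tabulate node-apart ∷ rest-apart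
    ; leaves = begin
        cluster (node s tt t) ++ R        ≡⟨ cong (_++ R) (cluster-node s t) ⟩
        (cluster s ++ cluster t) ++ R     ≡⟨ ++-assoc (cluster s) (cluster t) R ⟩
        cluster s ++ cluster t ++ R       ↭⟨ shifts (cluster s) (cluster t) ⟩
        cluster t ++ cluster s ++ R       ↭⟨ ++⁺ˡ (cluster t) leaves ⟩
        cluster t ++ v ∷ concatMap cluster F ↭⟨ shift v (cluster t) _ ⟩
        v ∷ cluster t ++ concatMap cluster F ∎
    }
    where
    open Absorbed a renaming (tree to s)
    open PermutationReasoning
    R = concatMap cluster rest

    s-apart    = λ {u} → All.lookup (AllPairs.head apart) {u}
    rest-apart = AllPairs.tail apart

    joint : ∃[ x ] ∃[ y ] x ∈ᵗ s × y ∈ᵗ t × x ~ y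
    joint with find v~t
    ... | y , y∈t , v~y = v , y , v∈tree , y∈t , v~y

    s-vs-t : ∀ {x y} → x ∈ᵗ s → y ∈ᵗ t → x ≡ v ⊎ (x ≢ y × ¬ x ~ y)
    s-vs-t x∈s y∈t with origin x∈s
    ... | inj₁ x≡v              = inj₁ x≡v
    ... | inj₂ (u , u∈F , x∈u) = inj₂ (apart-sym t u (All.lookup tF u∈F) x∈u y∈t)

    dst : Distinct (node s tt t)
    dst = distinctᵗ grown , distinctᵗ gt , disjoint
      where
      disjoint : ∀ {x} → x ∈ᵗ s → x ∉ᵗ t
      disjoint x∈s x∈t with s-vs-t x∈s x∈t
      ... | inj₁ refl      = v∉t x∈t
      ... | inj₂ (x≢x , _) = x≢x refl

    low′ : LowEdges L (node s tt t)
    low′ j x~y x∈ y∈ with position s t dst x∈ y∈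
    ... | left  x∈s y∈s eq rewrite eq = low grown j x~y x∈s y∈s
    ... | right x∈t y∈t eq rewrite eq = low gt j x~y x∈t y∈t
    ... | split (inj₁ (x∈s , y∈t)) _ with s-vs-t x∈s y∈t
    ...   | inj₁ refl      = ⊥-elim (v∉L (proj₁ (joins-∈ j)))
    ...   | inj₂ (_ , x≁y) = ⊥-elim (x≁y x~y)
    low′ j x~y x∈ y∈ | split (inj₂ (x∈t , y∈s)) _ with s-vs-t y∈s x∈t
    ...   | inj₁ refl      = ⊥-elim (v∉L (proj₂ (joins-∈ j)))
    ...   | inj₂ (_ , y≁x) = ⊥-elim (y≁x (~-sym x~y))

    origin′ : ∀ {x} → x ∈ᵗ node s tt t → x ≡ v ⊎ (∃[ u ] u ∈ t ∷ F × x ∈ᵗ u)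
    origin′ x∈ with ∈-node⁻ {l = s} {t} x∈
    ... | inj₂ x∈t = inj₂ (t , here refl , x∈t)
    ... | inj₁ x∈s with origin x∈s
    ...   | inj₁ x≡v             = inj₁ x≡v
    ...   | inj₂ (u , u∈F , x∈u) = inj₂ (u , there u∈F , x∈u)

    node-apart : ∀ {u} → u ∈ rest → Apart (node s tt t) u
    node-apart u∈rest x∈ y∈u with ∈-node⁻ {l = s} {t} x∈
    ... | inj₁ x∈s = s-apart u∈rest x∈s y∈u
    ... | inj₂ x∈t = All.lookup tF (rest⊆ u∈rest) x∈t y∈u
  ... | a | no v≁t = record
    { tree   = s
    ; rest   = t ∷ rest
    ; v∈tree = v∈tree
    ; grown  = grown
    ; origin = origin′
    ; rest⊆  = λ { (here refl) → here refl ; (there u∈) → there (rest⊆ u∈) }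
    ; apart  = ((λ {x} {y} → s-vs-t {x} {y}) ∷ AllPairs.head apart)
               ∷ (All.tabulate (λ u∈ → All.lookup tF (rest⊆ u∈)) ∷ AllPairs.tail apart)
    ; leaves = begin
        cluster s ++ cluster t ++ R       ↭⟨ shifts (cluster s) (cluster t) ⟩
        cluster t ++ cluster s ++ R       ↭⟨ ++⁺ˡ (cluster t) leaves ⟩
        cluster t ++ v ∷ concatMap cluster F ↭⟨ shift v (cluster t) _ ⟩
        v ∷ cluster t ++ concatMap cluster F ∎
    }
    where
    open Absorbed a renaming (tree to s)
    open PermutationReasoning
    R = concatMap cluster rest

    origin′ : ∀ {x} → x ∈ᵗ s → x ≡ v ⊎ (∃[ u ] u ∈ t ∷ F × x ∈ᵗ u)
    origin′ x∈s with origin x∈s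
    ... | inj₁ x≡v             = inj₁ x≡v
    ... | inj₂ (u , u∈F , x∈u) = inj₂ (u , there u∈F , x∈u)

    s-vs-t : Apart s t
    s-vs-t x∈s y∈t with origin x∈s
    ... | inj₂ (u , u∈F , x∈u) = apart-sym t u (All.lookup tF u∈F) x∈u y∈t
    ... | inj₁ refl = (λ { refl → v∉t y∈t }) , λ v~y → v≁t (lose y∈t v~y)

  -- A new edge ends in the new vertex v, and its lowest common ancestor lies in
  -- the tree of v, which has at most one leaf more than L.
  grow : ∀ L → Unique L → ∃[ F ] IsForest L F
  grow []      _         = [] , record { grown = [] ; apart = [] ; leaves = ↭-refl }
  grow (v ∷ L) (v∉ ∷ uL) with grow L uL
  ... | F , forest = tree ∷ rest , record
    { grown  = record { connectedᵗ = connectedᵗ grown ; distinctᵗ = distinctᵗ grown ; low = low-tree }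
               ∷ All.tabulate grown-rest
    ; apart  = apart
    ; leaves = leaves′
    }
    where
    module F = IsForest forest
    v∉L : v ∉ L
    v∉L v∈L = All.lookup v∉ v∈L refl
    fresh : ∀ {t} → t ∈ F → v ∉ᵗ t
    fresh t∈F v∈t = v∉L (∈-resp-↭ F.leaves (∈-concatMap⁺ cluster (lose t∈F v∈t)))
    open Absorbed (absorb v L F v∉L (All.tabulate fresh) F.grown F.apart)

    leaves′ : concatMap cluster (tree ∷ rest) ↭ v ∷ L
    leaves′ = ↭-trans leaves (prep v F.leaves)

    rank-tree : rank tree ≤ℕ length L
    rank-tree = ℕ.∸-monoˡ-≤ 1 (ℕ.≤-trans (ℕ.m≤m+n (size tree) _)
      (ℕ.≤-reflexive (≡.trans (sym (length-++ (cluster tree))) (↭-length leaves′))))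

    low-tree : LowEdges (v ∷ L) tree
    low-tree (here _)  _   x∈ y∈ = ℕ.≤-trans (lca-≤ rank-mono tree (distinctᵗ grown) x∈ y∈) rank-tree
    low-tree (there j) x~y x∈ y∈ = low grown j x~y x∈ y∈

    grown-rest : ∀ {t} → t ∈ rest → Grown (v ∷ L) t
    grown-rest {t} t∈ = record { connectedᵗ = connectedᵗ g ; distinctᵗ = distinctᵗ g ; low = low-t }
      where
      g = All.lookup F.grown (rest⊆ t∈)
      low-t : LowEdges (v ∷ L) t
      low-t (here _)  _   x∈ _  = ⊥-elim (fresh (rest⊆ t∈) x∈)
      low-t (there j) x~y x∈ y∈ = low g j x~y x∈ y∈

  firstStep : ∀ {k x y} → x ≢ y → Walk _~_ k x y → ∃[ z ] x ~ z
  firstStep x≢y []      = ⊥-elim (x≢y refl)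
  firstStep x≢y (e ∷ p) = _ , e

  closed-walk : ∀ {P : Fin n → Set} {k x y} → (∀ {x y} → P x → x ~ y → P y) → Walk _~_ k x y → P x → P y
  closed-walk step []      px = px
  closed-walk step (e ∷ p) px = closed-walk step p (step px e)

  -- Once all vertices have arrived the forest is a single tree: two trees would
  -- be apart, but a walk of the connected graph leads from one to the other.
  grownHierarchy : ∀ L → L ↭ allFin n → Fin n → ∃[ t ] Spans t × Connected t × LowEdges L t
  grownHierarchy L L↭ o with grow L (Unique-resp-↭ (↭-sym L↭) (allFin⁺ n))
  ... | [] , forest = ⊥-elim (absurd (∈-resp-↭ (↭-sym (↭-trans (IsForest.leaves forest) L↭)) (∈-allFin o)))
    where
    absurd : o ∉ []
    absurd ()
  ... | t ∷ [] , forest =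
    t , ↭-trans (↭-reflexive (sym (++-identityʳ (cluster t)))) (↭-trans leaves L↭) ,
    connectedᵗ (All.head grown) , low (All.head grown)
    where open IsForest forest
  ... | t ∷ u ∷ F , forest with someLeaf t | someLeaf u | IsForest.apart forest
  ...   | x , x∈t | y , y∈u | t-apart ∷ _ =
    ⊥-elim (proj₁ (All.head t-apart (closed-walk step (proj₂ (connected x y)) x∈t) y∈u) refl)
    where
    step : ∀ {x z} → x ∈ᵗ t → x ~ z → z ∈ᵗ t
    step {z = z} x∈t x~z
      with ∈-++⁻ (cluster t) (∈-resp-↭ (↭-sym (↭-trans (IsForest.leaves forest) L↭)) (∈-allFin z))
    ... | inj₁ z∈t = z∈t
    ... | inj₂ z∈uF with find (∈-concatMap⁻ cluster {xs = u ∷ F} z∈uF)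
    ...   | s , s∈ , z∈s = ⊥-elim (proj₂ (All.lookup t-apart s∈ x∈t z∈s) x~z)

-- Ultrametrics from hierarchies and hierarchies from ultrametrics

module _ (ℝ : RealNumbers) where
  open Optimisation ℝ
  open Reals ℝ
  private
    module ⊔ = Max totalOrder
    module Extrema = Data.List.Extrema totalOrder
  open RingProperties R.ring using (+-cancelʳ)
  open TotalOrderProperties totalOrder using (≰⇒≥)

  module _ {n : ℕ} where


    treeUltrametric : ∀ {g : VTree n → ℕ} → Monotone g →
      (∀ s {x y} → x ≢ y → x ∈ᵗ s → y ∈ᵗ s → 1 ≤ℕ g s) →
      ∀ t → Spans t → IsUltrametric (λ x y → fromℕ (treeMetric g t x y))
    treeUltrametric {g} mono pos t t↭ = record
      { isMetric = record
        { isSemiMetric = record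
          { isQuasiSemiMetric = record
            { isPreMetric = record
              { isProtoMetric = record
                { isPartialOrder  = O.isPartialOrder
                ; ≈-isEquivalence = ≡.isEquivalence
                ; cong            = λ { refl refl → R.refl }
                ; nonNegative     = λ {x} {y} → fromℕ-nonNegative (treeMetric g t x y)
                }
              ; ≈⇒0 = λ { {x} refl → R.reflexive (cong fromℕ (treeMetric-refl g t x)) }
              }
            ; 0⇒≈ = 0⇒≡
            }
          ; sym = λ x y → R.reflexive (cong fromℕ (treeMetric-sym g t x y))
          }
        ; triangle = λ x y z → [ (λ le → O.trans (fromℕ-mono-≤ le) (x≤x+y (fromℕ-nonNegative (treeMetric g t y z))))
                               , (λ le → O.trans (fromℕ-mono-≤ le)
                                   (O.≤-respʳ-≈ (R.+-comm _ _) (x≤x+y (fromℕ-nonNegative (treeMetric g t x y))))) ]′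
                               (treeMetric-ultra mono t t↭ x y z)
        }
      ; ultraTriangle = λ x y z → [ (λ le → O.trans (fromℕ-mono-≤ le) (⊔.x≤x⊔y _ _))
                                  , (λ le → O.trans (fromℕ-mono-≤ le) (⊔.x≤y⊔x _ _)) ]′
                                  (treeMetric-ultra mono t t↭ x y z)
      }
      where
      0⇒≡ : ∀ {x y} → fromℕ (treeMetric g t x y) ≈ 0# → x ≡ y
      0⇒≡ {x} {y} eq with x ≟ y
      ... | yes x≡y = x≡y
      ... | no x≢y  =
        let x∈ , y∈ = lca-∋ t (spans-distinct t t↭) (spans-∈ t t↭ x) (spans-∈ t t↭ y)
        in ⊥-elim (ℕ.<⇒≢ (pos (lca t x y) x≢y x∈ y∈) (sym (fromℕ≈0⇒≡0 _ eq)))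

    -- The trees satisfying P have n leaves each, so the list of candidates is
    -- complete.
    minimiser : ∀ {P : VTree n → Set} → (∀ t → Dec (P t)) → (∀ {t} → P t → Spans t) →
                (f : VTree n → Carrier) → ∃[ t ] P t → ∃[ t ] P t × (∀ s → P s → f t ≤ f s)
    minimiser {P} P? P⇒spans f (t₀ , p₀) =
      Extrema.argmin f t₀ candidates ,
      Extrema.argmin-all f p₀ (All.all-filter P? (treesUpTo n)) ,
      λ s ps → All.lookup (Extrema.f[argmin]≤f[xs] t₀ candidates)
        (∈-filter⁺ P? (treesUpTo-complete n s (ℕ.≤-reflexive (spans-size s (P⇒spans ps)))) ps)
      where
      candidates : List (VTree n)
      candidates = filter P? (treesUpTo n)

    module _ (u : Fin n → Fin n → Carrier) (u-sym : ∀ x y → u x y ≈ u y x)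
             (u-ultra : ∀ x y z → u x z ≤ u x y ⊎ u x z ≤ u y z) where

      -- The u-diameter D of a node is the u-distance of every pair that the node
      -- separates, as in the tree of closed balls of u.
      Aggregated : VTree n → Set
      Aggregated (leaf _)     = ⊤
      Aggregated (node l _ r) = Aggregated l × Aggregated r ×
        (∃[ D ] (∀ {x y} → x ∈ᵗ l → y ∈ᵗ r → D ≤ u x y) ×
                (∀ {a b} → a ∈ cluster (node l tt r) → b ∈ cluster (node l tt r) → u a b ≤ D))

      -- A point v within D of one point z of a set of diameter at most D can join
      -- the set without exceeding this bound.
      ball : ∀ {v z D} {S : List (Fin n)} → z ∈ S → u v z ≤ D →
             (∀ {a b} → a ∈ S → b ∈ S → u a b ≤ D) →
             ∀ {a b} → a ∈ v ∷ S → b ∈ v ∷ S → u a b ≤ D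
      ball {v} {z} z∈ vz≤D S≤D (here refl) (here refl) with u-ultra v z v
      ... | inj₁ le = O.trans le vz≤D
      ... | inj₂ le = O.trans le (O.trans (O.reflexive (u-sym z v)) vz≤D)
      ball {v} {z} z∈ vz≤D S≤D {b = b} (here refl) (there b∈) with u-ultra v z b
      ... | inj₁ le = O.trans le vz≤D
      ... | inj₂ le = O.trans le (S≤D z∈ b∈)
      ball {v} {z} z∈ vz≤D S≤D {a = a} (there a∈) (here refl) with u-ultra a z v
      ... | inj₁ le = O.trans le (S≤D a∈ z∈)
      ... | inj₂ le = O.trans le (O.trans (O.reflexive (u-sym z v)) vz≤D)
      ball z∈ vz≤D S≤D (there a∈) (there b∈) = S≤D a∈ b∈

      -- If v is strictly closer than D to z, then v sees points far from z as z
      -- does: in an ultrametric triangle the two longest sides are equal.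
      far : ∀ {v z D y} → ¬ D ≤ u v z → D ≤ u z y → D ≤ u v y
      far {v} {z} {D} {y} D≰vz D≤zy with u-ultra z v y
      ... | inj₁ le = ⊥-elim (D≰vz (O.trans D≤zy (O.trans le (O.reflexive (u-sym z v)))))
      ... | inj₂ le = O.trans D≤zy le

      Inserted : Fin n → VTree n → Set
      Inserted v t = ∃[ s ] cluster s ↭ v ∷ cluster t × Aggregated s

      -- When no pair of t is further apart than v is from t, all points of t are at
      -- the same distance from v, and v splits off at a new root.
      newRoot : ∀ v t → Aggregated t →
                (∀ {a b z} → a ∈ᵗ t → b ∈ᵗ t → z ∈ᵗ t → u a b ≤ u v z) → Inserted v t
      newRoot v t agg t≤v with someLeaf t
      ... | z , z∈t = node (leaf v) tt t , ↭-refl , tt , agg , u v z ,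
        (λ { (here refl) y∈t → nearest y∈t }) ,
        ball z∈t O.refl (λ a∈ b∈ → t≤v a∈ b∈ z∈t)
        where
        nearest : ∀ {y} → y ∈ᵗ t → u v z ≤ u v y
        nearest {y} y∈t with u-ultra v y z
        ... | inj₁ le = le
        ... | inj₂ le = O.trans le (t≤v y∈t z∈t y∈t)

      -- With D the diameter of the root, v descends to a child that has a point
      -- closer to v than D; if neither child has one, v is split off at the root.
      insert : ∀ v t → Aggregated t → Inserted v t
      insert v (leaf z) agg = newRoot v (leaf z) agg
        λ { (here refl) (here refl) (here refl) →
            [ (λ le → O.trans le (O.reflexive (u-sym z v))) , id ]′ (u-ultra z v z) }
      insert v t@(node l _ r) agg@(al , ar , D , cross , diam≤)
        with Any.any? (λ z → ¬? (D O.≤? u v z)) (cluster l)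
           | Any.any? (λ z → ¬? (D O.≤? u v z)) (cluster r)
      ... | yes near | _ =
        let z , z∈l , D≰vz = find near
            s , s↭ , as    = insert v l al
            t↭ = ↭-trans (↭-reflexive (cluster-node s r))
                   (↭-trans (++⁺ʳ (cluster r) s↭) (↭-reflexive (cong (v ∷_) (sym (cluster-node l r)))))
            z∈t = ∈-nodeˡ {l = l} {r} z∈l
        in node s tt r , t↭ , as , ar , D ,
           (λ x∈s y∈r → cross′ D≰vz z∈l (∈-resp-↭ s↭ x∈s) y∈r) ,
           λ a∈ b∈ → ball z∈t (≰⇒≥ D≰vz) diam≤ (∈-resp-↭ t↭ a∈) (∈-resp-↭ t↭ b∈)
        where
        cross′ : ∀ {z x y} → ¬ D ≤ u v z → z ∈ᵗ l → x ∈ v ∷ cluster l → y ∈ᵗ r → D ≤ u x y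
        cross′ D≰vz z∈l (here refl) y∈r = far D≰vz (cross z∈l y∈r)
        cross′ D≰vz z∈l (there x∈l) y∈r = cross x∈l y∈r
      ... | no _ | yes near =
        let z , z∈r , D≰vz = find near
            s , s↭ , as    = insert v r ar
            t↭ = ↭-trans (↭-reflexive (cluster-node l s))
                   (↭-trans (++⁺ˡ (cluster l) s↭)
                     (↭-trans (shift v (cluster l) (cluster r))
                       (↭-reflexive (cong (v ∷_) (sym (cluster-node l r))))))
            z∈t = ∈-nodeʳ {l = l} {r} z∈r
        in node l tt s , t↭ , al , as , D ,
           (λ x∈l y∈s → cross′ D≰vz z∈r x∈l (∈-resp-↭ s↭ y∈s)) ,
           λ a∈ b∈ → ball z∈t (≰⇒≥ D≰vz) diam≤ (∈-resp-↭ t↭ a∈) (∈-resp-↭ t↭ b∈)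
        where
        cross′ : ∀ {z x y} → ¬ D ≤ u v z → z ∈ᵗ r → x ∈ᵗ l → y ∈ v ∷ cluster r → D ≤ u x y
        cross′ {x = x} D≰vz z∈r x∈l (here refl) = O.trans
          (far D≰vz (O.trans (cross x∈l z∈r) (O.reflexive (u-sym x _)))) (O.reflexive (u-sym v x))
        cross′ D≰vz z∈r x∈l (there y∈r) = cross x∈l y∈r
      ... | no ¬nearˡ | no ¬nearʳ = newRoot v t agg
        λ a∈ b∈ z∈ → O.trans (diam≤ a∈ b∈) (D≤ z∈)
        where
        D≤ : ∀ {z} → z ∈ᵗ t → D ≤ u v z
        D≤ {z} z∈ with D O.≤? u v z
        ... | yes le = le
        ... | no D≰vz = ⊥-elim ([ (λ z∈l → ¬nearˡ (lose z∈l D≰vz)) , (λ z∈r → ¬nearʳ (lose z∈r D≰vz)) ]′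
                                (∈-node⁻ {l = l} {r} z∈))

      aggregate : ∀ v L → ∃[ t ] cluster t ↭ v ∷ L × Aggregated t
      aggregate v []      = leaf v , ↭-refl , tt
      aggregate v (w ∷ L) =
        let t , t↭ , at = aggregate w L
            s , s↭ , as = insert v t at
        in s , ↭-trans s↭ (prep v t↭) , as

      lca-diameter : ∀ t → Distinct t → Aggregated t → ∀ {x y} → x ≢ y → x ∈ᵗ t → y ∈ᵗ t →
                     ∀ {a b} → a ∈ᵗ lca t x y → b ∈ᵗ lca t x y → u a b ≤ u x y
      lca-diameter (leaf _) _ _ x≢y (here refl) (here refl) = ⊥-elim (x≢y refl)
      lca-diameter (node l _ r) d@(dl , dr , _) (al , ar , D , cross , diam≤) x≢y x∈ y∈ a∈ b∈
        with position l r d x∈ y∈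
      ... | left  x∈l y∈l eq rewrite eq = lca-diameter l dl al x≢y x∈l y∈l a∈ b∈
      ... | right x∈r y∈r eq rewrite eq = lca-diameter r dr ar x≢y x∈r y∈r a∈ b∈
      ... | split (inj₁ (x∈l , y∈r)) eq rewrite eq = O.trans (diam≤ a∈ b∈) (cross x∈l y∈r)
      ... | split (inj₂ (x∈r , y∈l)) eq rewrite eq =
        O.trans (diam≤ a∈ b∈) (O.trans (cross y∈l x∈r) (O.reflexive (u-sym _ _)))

  -- Arrival orders of small cost

  module _ {A : Set} (w : A → A → Carrier) (w-sym : ∀ x y → w x y ≈ w y x)
           (w-diagonal : ∀ x → w x x ≈ 0#) where

    -- Charges every pair, in both orientations, its weight times the number of
    -- vertices present before its later end arrives.
    arrivalCost : List A → Carrier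
    arrivalCost []      = 0#
    arrivalCost (v ∷ L) = arrivalCost L + (∑ L (w v) + ∑ L (w v)) * fromℕ (length L)

    ∑²≤arrivalCost : ∀ (h : A → A → ℕ) → (∀ x y → h x y ≡ h y x) → ∀ L →
      (∀ {x y k} → Joins L x y k → w x y * fromℕ (h x y) ≤ w x y * fromℕ k) →
      ∑² L (λ x y → w x y * fromℕ (h x y)) ≤ arrivalCost L
    ∑²≤arrivalCost h h-sym []      _   = O.refl
    ∑²≤arrivalCost h h-sym (v ∷ L) low = begin
      ∑² (v ∷ L) f
        ≈⟨ ∑²-∷ v L f-sym (R.trans (R.*-congʳ (w-diagonal v)) (R.zeroˡ _)) ⟩
      ∑² L f + (∑ L (f v) + ∑ L (f v))
        ≤⟨ +-mono-≤ (∑²≤arrivalCost h h-sym L (low ∘ there)) (+-mono-≤ star star) ⟩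
      arrivalCost L + (∑ L (w v) * ℓ + ∑ L (w v) * ℓ)
        ≈⟨ R.+-congˡ (R.sym (R.distribʳ ℓ _ _)) ⟩
      arrivalCost L + (∑ L (w v) + ∑ L (w v)) * ℓ ∎
      where
      f : A → A → Carrier
      f x y = w x y * fromℕ (h x y)
      f-sym : ∀ x y → f x y ≈ f y x
      f-sym x y = R.*-cong (w-sym x y) (R.reflexive (cong fromℕ (h-sym x y)))
      ℓ = fromℕ (length L)
      star : ∑ L (f v) ≤ ∑ L (w v) * ℓ
      star = begin
        ∑ L (f v)             ≤⟨ ∑-mono L (λ y∈L → low (here y∈L)) ⟩
        ∑ L (λ y → w v y * ℓ) ≈⟨ ∑-*ʳ L (w v) ℓ ⟩
        ∑ L (w v) * ℓ         ∎

    -- The least degree is at most the average degree.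
    minDegree : ∀ s S → ∃[ v ] v ∈ s ∷ S ×
      fromℕ (length (s ∷ S)) * ∑ (s ∷ S) (w v) ≤ ∑² (s ∷ S) w
    minDegree s S =
      v , v∈ (Extrema.argmin-sel degree s S) ,
      O.trans (O.reflexive (R.sym (∑-const (s ∷ S) (degree v)))) (∑-mono (s ∷ S) least-degree)
      where
      degree : A → Carrier
      degree x = ∑ (s ∷ S) (w x)
      v : A
      v = Extrema.argmin degree s S
      v∈ : v ≡ s ⊎ v ∈ S → v ∈ s ∷ S
      v∈ (inj₁ v≡s) = here v≡s
      v∈ (inj₂ v∈S) = there v∈S
      least-degree : ∀ {x} → x ∈ s ∷ S → degree v ≤ degree x
      least-degree (here refl) = Extrema.f[argmin]≤f[⊤] {f = degree} s S
      least-degree (there x∈S) = All.lookup (Extrema.f[argmin]≤f[xs] {f = degree} s S) x∈S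

    -- A vertex v of least degree d arrives last.  With m other vertices and E the
    -- sum over ordered pairs of these, it adds 6 d m to the first term and 2 d to
    -- the second, while the right side grows by 2 E + 4 d m + 4 d; the difference
    -- is nonnegative because (m + 1) d ≤ E + 2 d, the least degree being at most
    -- the average.
    cheapOrder : ∀ m S → length S ≡ m → ∃[ L ] L ↭ S ×
      fromℕ 3 * arrivalCost L + ∑² L w ≤ fromℕ 2 * fromℕ (length L) * ∑² L w
    cheapOrder zero [] _ = [] , ↭-refl , O.reflexive
      (solve 0 (((con 1 :+ (con 1 :+ (con 1 :+ con 0))) :* con 0 :+ con 0)
        := (con 1 :+ (con 1 :+ con 0)) :* con 0 :* con 0) R.refl)
    cheapOrder (suc m) (s ∷ S) eq with minDegree s S
    ... | v , v∈ , least with extract v∈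
    ...   | S′ , S↭ with cheapOrder m S′ (ℕ.suc-injective (≡.trans (sym (↭-length S↭)) eq))
    ...     | L , L↭ , bound = v ∷ L , vL↭ , (begin
      fromℕ 3 * (c + (d + d) * ℓ) + ∑² (v ∷ L) w
        ≈⟨ R.+-congˡ E′ ⟩
      fromℕ 3 * (c + (d + d) * ℓ) + (E + (d + d))
        ≈⟨ solve 4 (λ c d ℓ E →
             (con 1 :+ (con 1 :+ (con 1 :+ con 0))) :* (c :+ (d :+ d) :* ℓ) :+ (E :+ (d :+ d))
             := ((con 1 :+ (con 1 :+ (con 1 :+ con 0))) :* c :+ E)
                :+ (((con 1 :+ ℓ) :* d :+ (con 1 :+ ℓ) :* d) :+ con 4 :* (ℓ :* d)))
             R.refl c d ℓ E ⟩
      (fromℕ 3 * c + E) + (((1# + ℓ) * d + (1# + ℓ) * d) + _)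
        ≤⟨ +-mono-≤ bound (+-mono-≤ (+-mono-≤ degree-bound degree-bound) O.refl) ⟩
      fromℕ 2 * ℓ * E + (((E + (d + d)) + (E + (d + d))) + _)
        ≈⟨ solve 3 (λ d ℓ E →
             (con 1 :+ (con 1 :+ con 0)) :* ℓ :* E
               :+ (((E :+ (d :+ d)) :+ (E :+ (d :+ d))) :+ con 4 :* (ℓ :* d))
             := (con 1 :+ (con 1 :+ con 0)) :* (con 1 :+ ℓ) :* (E :+ (d :+ d)))
             R.refl d ℓ E ⟩
      fromℕ 2 * (1# + ℓ) * (E + (d + d))
        ≈⟨ R.*-congˡ E′ ⟨
      fromℕ 2 * (1# + ℓ) * ∑² (v ∷ L) w ∎)
      where
      c = arrivalCost L
      d = ∑ L (w v)
      ℓ = fromℕ (length L)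
      E = ∑² L w
      vL↭ : v ∷ L ↭ s ∷ S
      vL↭ = ↭-trans (prep v L↭) (↭-sym S↭)
      E′ : ∑² (v ∷ L) w ≈ E + (d + d)
      E′ = ∑²-∷ v L w-sym (w-diagonal v)
      d≈ : d ≈ ∑ (s ∷ S) (w v)
      d≈ = begin-equality
        d               ≈⟨ R.+-identityˡ d ⟨
        0# + d          ≈⟨ R.+-congʳ (w-diagonal v) ⟨
        w v v + d       ≈⟨ ∑-↭ (w v) vL↭ ⟩
        ∑ (s ∷ S) (w v) ∎
      degree-bound : (1# + ℓ) * d ≤ E + (d + d)
      degree-bound = begin
        (1# + ℓ) * d
          ≈⟨ R.*-cong (R.reflexive (cong fromℕ (↭-length vL↭))) d≈ ⟩
        fromℕ (length (s ∷ S)) * ∑ (s ∷ S) (w v)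
          ≤⟨ least ⟩
        ∑² (s ∷ S) w
          ≈⟨ ∑²-↭ w vL↭ ⟨
        ∑² (v ∷ L) w
          ≈⟨ E′ ⟩
        E + (d + d) ∎

  -- The two optima of a weighted graph

  module _ {n : ℕ} (G : WeightedGraph n) where
    open WeightedGraph G

    private
      V : List (Fin n)
      V = allFin n

    edgeWeight : Fin n → Fin n → Carrier
    edgeWeight x y = if does (x ~? y) then weight x y else 0#

    edgeWeight-sym : ∀ x y → edgeWeight x y ≈ edgeWeight y x
    edgeWeight-sym x y with x ~? y | y ~? x
    ... | yes x~y | yes _   = weight-sym x~y
    ... | no  _   | no  _   = R.refl
    ... | yes x~y | no y≁x  = ⊥-elim (y≁x (~-sym x~y))
    ... | no x≁y  | yes y~x = ⊥-elim (x≁y (~-sym y~x))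

    edgeWeight-diagonal : ∀ x → edgeWeight x x ≈ 0#
    edgeWeight-diagonal x with x ~? x
    ... | yes x~x = ⊥-elim (~-irrefl refl x~x)
    ... | no _    = R.refl

    ∈-edges⁻ : ∀ {x y} → (x , y) ∈ edges → x ~ y
    ∈-edges⁻ e = proj₂ (proj₂ (∈-filter⁻ (λ (x , y) → (x <ᶠ? y) ×-dec (x ~? y)) {xs = cartesianProduct V V} e))

    edge : ∀ {x y} → x ~ y → ∃[ e ] e ∈ edges
    edge {x} {y} x~y with <-cmp x y
    ... | tri< x<y _ _  = (x , y) , ∈-filter⁺ _ (∈-cartesianProduct⁺ (∈-allFin x) (∈-allFin y)) (x<y , x~y)
    ... | tri≈ _ refl _ = ⊥-elim (~-irrefl refl x~y)
    ... | tri> _ _ y<x  = (y , x) , ∈-filter⁺ _ (∈-cartesianProduct⁺ (∈-allFin y) (∈-allFin x)) (y<x , ~-sym x~y)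

    cost-mono : ∀ {u v} → (∀ {x y} → x ~ y → u x y ≤ v x y) → cost u ≤ cost v
    cost-mono u≤v = ∑-mono edges λ e → let x~y = ∈-edges⁻ e in
      *-monoʳ-≤ (proj₁ (weight-positive x~y)) (u≤v x~y)

    -- Edges are listed as increasing pairs, so each adjacent ordered pair stems
    -- from exactly one of its two orientations.
    cost-doubled : ∀ {u} → (∀ x y → u x y ≈ u y x) →
                   cost u + cost u ≈ ∑² V (λ x y → edgeWeight x y * u x y)
    cost-doubled {u} u-sym = begin-equality
      cost u + cost u
        ≈⟨ R.+-cong cost≈ (R.trans cost≈ (∑-swap V V f)) ⟩
      ∑² V f + ∑² V (λ x y → f y x)
        ≈⟨ ∑-+ V _ _ ⟨
      ∑ V (λ x → ∑ V (f x) + ∑ V (λ y → f y x))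
        ≈⟨ ∑-cong V (λ {x} _ → R.sym (∑-+ V (f x) (λ y → f y x))) ⟩
      ∑² V (λ x y → f x y + f y x)
        ≈⟨ ∑²-cong V (λ {x} {y} _ _ → orientations x y) ⟩
      ∑² V (λ x y → edgeWeight x y * u x y) ∎
      where
      f : Fin n → Fin n → Carrier
      f x y = if does ((x <ᶠ? y) ×-dec (x ~? y)) then weight x y * u x y else 0#
      cost≈ : cost u ≈ ∑² V f
      cost≈ = R.trans (∑-filter (λ (x , y) → (x <ᶠ? y) ×-dec (x ~? y)) (cartesianProduct V V) _)
                      (∑-product V V _)
      orientations : ∀ x y → f x y + f y x ≈ edgeWeight x y * u x y
      orientations x y with x ~? y | y ~? x
      ... | yes x~y | no y≁x  = ⊥-elim (y≁x (~-sym x~y))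
      ... | no x≁y  | yes y~x = ⊥-elim (x≁y (~-sym y~x))
      ... | no _    | no _
        rewrite ∧-comm (does (x <ᶠ? y)) false | ∧-comm (does (y <ᶠ? x)) false =
          R.trans (R.+-identityˡ 0#) (R.sym (R.zeroˡ _))
      ... | yes x~y | yes y~x with <-cmp x y
      ...   | tri≈ _ refl _ = ⊥-elim (~-irrefl refl x~y)
      ...   | tri< x<y _ y≮x
        rewrite dec-true (x <ᶠ? y) x<y | dec-false (y <ᶠ? x) y≮x = R.+-identityʳ _
      ...   | tri> x≮y _ y<x
        rewrite dec-false (x <ᶠ? y) x≮y | dec-true (y <ᶠ? x) y<x =
          R.trans (R.+-identityˡ _) (R.*-cong (weight-sym y~x) (u-sym y x))

    totalWeight : Carrier
    totalWeight = cost (λ _ _ → 1#)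

    totalWeight-doubled : totalWeight + totalWeight ≈ ∑² V edgeWeight
    totalWeight-doubled = R.trans (cost-doubled (λ _ _ → R.refl))
      (∑²-cong V (λ _ _ → R.*-identityʳ _))

    totalWeight-positive : ∀ {x y} → x ~ y → 0# < totalWeight
    totalWeight-positive x~y =
      let (a , b) , e = edge x~y
          0≤w , 0≉w   = weight-positive (∈-edges⁻ e)
          w≤W         = O.≤-respˡ-≈ (R.*-identityʳ (weight a b)) (∑-member edges
                          (λ e′ → *-nonNegative (proj₁ (weight-positive (∈-edges⁻ e′))) 0≤1) e)
      in O.trans 0≤w w≤W , λ 0≈W → 0≉w (O.antisym 0≤w (O.≤-respʳ-≈ (R.sym 0≈W) w≤W))

    hierarchyCost : VTree n → Carrier
    hierarchyCost t = cost (λ x y → fromℕ (treeMetric rank t x y))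

    -- Cheap arrival orders exist, and a hierarchy grown along one costs at most as
    -- much as the order.
    cheapHierarchy : Fin n → ∃[ t ] Spans t × (∀ x y → dist x y ≤ℕ treeMetric rank t x y) ×
      fromℕ 3 * hierarchyCost t + totalWeight ≤ fromℕ 2 * fromℕ n * totalWeight
    cheapHierarchy o =
      let L , L↭ , bound        = cheapOrder edgeWeight edgeWeight-sym edgeWeight-diagonal n V (length-tabulate id)
          t , t↭ , conn , low   = grownHierarchy graph L L↭ o
      in t , t↭ , connected⇒dist≤rank graph t t↭ conn , double-cancel-≤ (begin
        (fromℕ 3 * hierarchyCost t + totalWeight) + (fromℕ 3 * hierarchyCost t + totalWeight)
          ≈⟨ solve 3 (λ k c W → (k :* c :+ W) :+ (k :* c :+ W) := k :* (c :+ c) :+ (W :+ W)) R.refl _ _ _ ⟩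
        fromℕ 3 * (hierarchyCost t + hierarchyCost t) + (totalWeight + totalWeight)
          ≈⟨ R.+-cong (R.*-congˡ (R.trans (cost-doubled (λ x y → R.reflexive (cong fromℕ (treeMetric-sym rank t x y))))
                                          (∑²-↭ _ (↭-sym L↭))))
                      (R.trans totalWeight-doubled (∑²-↭ _ (↭-sym L↭))) ⟩
        fromℕ 3 * ∑² L (λ x y → edgeWeight x y * fromℕ (treeMetric rank t x y)) + ∑² L edgeWeight
          ≤⟨ +-mono-≤ (*-monoʳ-≤ (fromℕ-nonNegative 3)
               (∑²≤arrivalCost edgeWeight edgeWeight-sym edgeWeight-diagonal
                 (treeMetric rank t) (treeMetric-sym rank t) L (heights t t↭ low))) O.refl ⟩
        fromℕ 3 * arrivalCost edgeWeight edgeWeight-sym edgeWeight-diagonal L + ∑² L edgeWeight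
          ≤⟨ bound ⟩
        fromℕ 2 * fromℕ (length L) * ∑² L edgeWeight
          ≈⟨ R.*-cong (R.*-congˡ (R.reflexive (cong fromℕ {x = length L} {y = n} (≡.trans (↭-length L↭) (length-tabulate id)))))
                      (R.trans (∑²-↭ _ L↭) (R.sym totalWeight-doubled)) ⟩
        fromℕ 2 * fromℕ n * (totalWeight + totalWeight)
          ≈⟨ R.distribˡ _ _ _ ⟩
        fromℕ 2 * fromℕ n * totalWeight + fromℕ 2 * fromℕ n * totalWeight ∎)
      where
      heights : ∀ t → Spans t → ∀ {L} → LowEdges graph L t → ∀ {x y k} → Joins L x y k →
                edgeWeight x y * fromℕ (treeMetric rank t x y) ≤ edgeWeight x y * fromℕ k
      heights t t↭ low {x} {y} j with x ~? y
      ... | no _    = O.reflexive (R.trans (R.zeroˡ _) (R.sym (R.zeroˡ _)))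
      ... | yes x~y = *-monoʳ-≤ (proj₁ (weight-positive x~y)) (fromℕ-mono-≤
        (ℕ.≤-trans (treeMetric-≤ rank t x y) (low j x~y (spans-∈ t t↭ x) (spans-∈ t t↭ y))))

    OPTcard-exists : Fin n → ∃[ a ] IsOPTcard G a
    OPTcard-exists o =
      let s , s↭ , s-feasible , _       = cheapHierarchy o
          t , (t↭ , t-feasible) , least = minimiser feasible? proj₁ hierarchyCost (s , s↭ , s-feasible)
      in hierarchyCost t ,
         (record { tree = t ; leaves-↭ = t↭ } , t-feasible , R.refl) ,
         λ H feasible → least (Hierarchy.tree H) (Hierarchy.leaves-↭ H , feasible)
      where
      feasible? : ∀ t → Dec (Spans t × (∀ x y → dist x y ≤ℕ treeMetric rank t x y))
      feasible? t = (_↭?_ _≟_ (cluster t) V) ×-dec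
        all? λ x → all? λ y → dist x y ℕ.≤? treeMetric rank t x y

    OPTcard-bound : ∀ {a} → Fin n → IsOPTcard G a →
      fromℕ 3 * a + totalWeight ≤ fromℕ 2 * fromℕ n * totalWeight
    OPTcard-bound o (_ , a-least) =
      let s , s↭ , s-feasible , s-cheap = cheapHierarchy o
      in O.trans (+-mono-≤ (*-monoʳ-≤ (fromℕ-nonNegative 3)
           (a-least (record { tree = s ; leaves-↭ = s↭ }) s-feasible)) O.refl) s-cheap

    diameter : VTree n → ℕ
    diameter t = max 0 (cartesianProductWith dist (cluster t) (cluster t))

    dist≤diameter : ∀ t {x y} → x ∈ cluster t → y ∈ cluster t → dist x y ≤ℕ diameter t
    dist≤diameter t x∈ y∈ = All.lookup (xs≤max 0 _) (∈-cartesianProductWith⁺ dist x∈ y∈)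

    diameter-least : ∀ t {P : ℕ → Set} → P 0 →
      (∀ {x y} → x ∈ cluster t → y ∈ cluster t → P (dist x y)) → P (diameter t)
    diameter-least t {P} p₀ p = argmax-all id {P = P} p₀ (All.tabulate λ d∈ →
      let x , y , x∈ , y∈ , eq = ∈-cartesianProductWith⁻ dist (cluster t) (cluster t) d∈
      in subst P (sym eq) (p x∈ y∈))

    diameter-mono : Monotone diameter
    diameter-mono l r =
      diameter-least l {_≤ℕ diameter (node l tt r)} z≤n
        (λ x∈ y∈ → dist≤diameter (node l tt r) (∈-nodeˡ {l = l} {r} x∈) (∈-nodeˡ {l = l} {r} y∈)) ,
      diameter-least r {_≤ℕ diameter (node l tt r)} z≤n
        (λ x∈ y∈ → dist≤diameter (node l tt r) (∈-nodeʳ {l = l} {r} x∈) (∈-nodeʳ {l = l} {r} y∈))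

    diameterCost : VTree n → Carrier
    diameterCost t = cost (λ x y → fromℕ (treeMetric diameter t x y))

    Feasible : (Fin n → Fin n → Carrier) → Set
    Feasible u = IsUltrametric u × (∀ x y → fromℕ (dist x y) ≤ u x y)

    diameter-feasible : ∀ t → Spans t → Feasible (λ x y → fromℕ (treeMetric diameter t x y))
    diameter-feasible t t↭ =
      treeUltrametric diameter-mono
        (λ s x≢y x∈ y∈ → ℕ.≤-trans (dist-pos graph x≢y) (dist≤diameter s x∈ y∈)) t t↭ ,
      λ x y → fromℕ-mono-≤ (bound x y)
      where
      bound : ∀ x y → dist x y ≤ℕ treeMetric diameter t x y
      bound x y with x ≟ y
      ... | yes refl = ℕ.≤-reflexive (dist-refl graph x)
      ... | no _     =
        let x∈ , y∈ = lca-∋ t (spans-distinct t t↭) (spans-∈ t t↭ x) (spans-∈ t t↭ y)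
        in dist≤diameter (lca t x y) x∈ y∈

    -- In a hierarchy aggregated by u the cluster of lca x y has u-diameter u x y,
    -- and u dominates the graph metric.
    diameter-dominates : Fin n → ∀ u → Feasible u → ∃[ t ] Spans t × diameterCost t ≤ cost u
    diameter-dominates o u (isUltra , dist≤u) =
      let v , V′ , V≡      = allFin-∷ o
          t , t↭ , agg     = aggregate u u-sym u-ultra v V′
          spans            = ↭-trans t↭ (↭-reflexive (sym V≡))
      in t , spans , cost-mono (pointwise t spans agg)
      where
      open IsUltrametric isUltra
      u-sym : ∀ x y → u x y ≈ u y x
      u-sym = IsGeneralMetric.sym isMetric
      u-ultra : ∀ x y z → u x z ≤ u x y ⊎ u x z ≤ u y z
      u-ultra x y z = Sum.map (λ eq → O.≤-respʳ-≈ eq (ultraTriangle x y z))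
                              (λ eq → O.≤-respʳ-≈ eq (ultraTriangle x y z))
                              (⊔.⊔-sel (u x y) (u y z))
      allFin-∷ : ∀ {n} → Fin n → ∃[ v ] ∃[ L ] allFin n ≡ v ∷ L
      allFin-∷ zero    = _ , _ , refl
      allFin-∷ (suc _) = _ , _ , refl
      pointwise : ∀ t → Spans t → Aggregated u u-sym u-ultra t →
                  ∀ {x y} → x ~ y → fromℕ (treeMetric diameter t x y) ≤ u x y
      pointwise t t↭ agg {x} {y} x~y with x ≟ y
      ... | yes refl = ⊥-elim (~-irrefl refl x~y)
      ... | no x≢y   = diameter-least (lca t x y) {λ d → fromℕ d ≤ u x y}
        (IsGeneralMetric.nonNegative isMetric)
        (λ {a} {b} a∈ b∈ → O.trans (dist≤u a b)
          (lca-diameter u u-sym u-ultra t (spans-distinct t t↭) agg x≢y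
            (spans-∈ t t↭ x) (spans-∈ t t↭ y) a∈ b∈))

    OPTfree-exists : Fin n → ∃[ b ] IsOPTfree G b
    OPTfree-exists o =
      let s , s↭ , _      = cheapHierarchy o
          t , t↭ , least  = minimiser (λ t → _↭?_ _≟_ (cluster t) V) id diameterCost (s , s↭)
      in diameterCost t ,
         (_ , diameter-feasible t t↭ , R.refl) ,
         λ u f → let s , s↭ , s≤u = diameter-dominates o u f in O.trans (least s s↭) s≤u

    -- Adjacent vertices have distance at least 1, hence u at least 1.
    totalWeight≤OPTfree : ∀ {b} → IsOPTfree G b → totalWeight ≤ b
    totalWeight≤OPTfree ((u , (_ , dist≤u) , cost≈b) , _) = O.≤-respʳ-≈ cost≈b
      (cost-mono λ {x} {y} x~y → O.trans
        (O.≤-respˡ-≈ (R.+-identityʳ 1#) (fromℕ-mono-≤ (dist-pos graph λ x≡y → ~-irrefl x≡y x~y))) (dist≤u x y))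

    -- The height of a hierarchy is an ultrametric.
    OPTfree≤OPTcard : ∀ {a b} → IsOPTcard G a → IsOPTfree G b → b ≤ a
    OPTfree≤OPTcard ((H , feasible , cost≈a) , _) (_ , b-least) = O.≤-respʳ-≈ cost≈a
      (b-least _ (treeUltrametric rank-mono rank-pos (Hierarchy.tree H) (Hierarchy.leaves-↭ H) ,
                  λ x y → fromℕ-mono-≤ (feasible x y)))

  -- Complete graphs

  module _ {n : ℕ} where
    private
      e : Fin n → Fin n → Carrier
      e = edgeWeight (K n)

    e-≢ : ∀ x y → x ≢ y → e x y ≈ 1#
    e-≢ x y x≢y with x ≟ y
    ... | yes x≡y = ⊥-elim (x≢y x≡y)
    ... | no _    = R.refl

    -- Twice the number of pairs of leaves of t, and twice the sum of their heights.
    pairs : VTree n → Carrier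
    pairs t = ∑² (cluster t) e

    heights : VTree n → Carrier
    heights t = ∑² (cluster t) (λ x y → e x y * fromℕ (treeMetric rank t x y))

    pairs-node : ∀ l r → Distinct (node l tt r) → let p = fromℕ (size l); q = fromℕ (size r) in
                 pairs (node l tt r) ≈ (pairs l + pairs r) + (p * (q * 1#) + p * (q * 1#))
    pairs-node l r (_ , _ , disjoint) rewrite cluster-node l r =
      R.trans (∑²-++ (cluster l) (cluster r) (edgeWeight-sym (K n))) (R.+-congˡ (R.+-cong cross cross))
      where
      cross = ∑-∑-const (cluster l) (cluster r) {e} 1#
        (λ {x} {y} x∈l y∈r → e-≢ x y λ { refl → disjoint x∈l y∈r })

    heights-node : ∀ l r → Distinct (node l tt r) →
      let p = fromℕ (size l); q = fromℕ (size r); k = fromℕ (rank (node l tt r)) in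
      heights (node l tt r) ≈ (heights l + heights r) + (p * (q * k) + p * (q * k))
    heights-node l r d@(dl , dr , disjoint) = begin-equality
      ∑² (cluster (node l tt r)) f
        ≈⟨ R.reflexive (cong (λ S → ∑² S f) (cluster-node l r)) ⟩
      ∑² (cluster l ++ cluster r) f
        ≈⟨ ∑²-++ (cluster l) (cluster r) f-sym ⟩
      (∑² (cluster l) f + ∑² (cluster r) f) + (_ + _)
        ≈⟨ R.+-cong (R.+-cong (∑²-cong (cluster l) inˡ) (∑²-cong (cluster r) inʳ)) (R.+-cong cross cross) ⟩
      (heights l + heights r) + (_ + _) ∎
      where
      h : VTree n → Fin n → Fin n → ℕ
      h = treeMetric rank
      f : Fin n → Fin n → Carrier
      f x y = e x y * fromℕ (h (node l tt r) x y)
      f-sym : ∀ x y → f x y ≈ f y x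
      f-sym x y = R.*-cong (edgeWeight-sym (K n) x y)
                           (R.reflexive (cong fromℕ (treeMetric-sym rank (node l tt r) x y)))
      descend : ∀ {s x y} → lca (node l tt r) x y ≡ lca s x y → f x y ≈ e x y * fromℕ (h s x y)
      descend {s} {x} {y} eq = R.*-congˡ (R.reflexive (cong fromℕ
        (cong (if does (x ≟ y) then 0 else_) (cong rank eq))))
      inˡ : ∀ {x y} → x ∈ cluster l → y ∈ cluster l → f x y ≈ e x y * fromℕ (h l x y)
      inˡ x∈l y∈l = descend {l} (lca-left l r x∈l y∈l)
      inʳ : ∀ {x y} → x ∈ cluster r → y ∈ cluster r → f x y ≈ e x y * fromℕ (h r x y)
      inʳ x∈r y∈r = descend {r} (lca-right l r (λ x∈l → disjoint x∈l x∈r) x∈r y∈r)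
      cross = ∑-∑-const (cluster l) (cluster r) {f} (fromℕ (rank (node l tt r))) λ {x} {y} x∈l y∈r →
        let x≢y : x ≢ y
            x≢y = λ { refl → disjoint x∈l y∈r } in
        R.trans (R.*-cong (e-≢ x y x≢y) (R.reflexive (cong fromℕ (≡.trans (treeMetric-≢ rank (node l tt r) x≢y)
          (cong rank (lca-split l r (disjoint x∈l) (λ y∈l → disjoint y∈l y∈r)))))))
          (R.*-identityˡ _)

    size-fromℕ : ∀ (l r : VTree n) → fromℕ (size (node l tt r)) ≈ fromℕ (size l) + fromℕ (size r)
    size-fromℕ l r = R.trans (R.reflexive (cong fromℕ (size-node l r))) (fromℕ-+ (size l) (size r))

    rank-fromℕ : ∀ (t : VTree n) → 1# + fromℕ (rank t) ≈ fromℕ (size t)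
    rank-fromℕ t = R.reflexive (cong fromℕ (ℕ.m+[n∸m]≡n (1≤size t)))

    pairs-size : ∀ t → Distinct t → pairs t + fromℕ (size t) ≈ fromℕ (size t) * fromℕ (size t)
    pairs-size (leaf x) _ = R.trans
      (R.+-congʳ (R.+-congʳ (R.+-congʳ (edgeWeight-diagonal (K n) x))))
      (solve 0 (((con 0 :+ con 0) :+ con 0) :+ (con 1 :+ con 0) := (con 1 :+ con 0) :* (con 1 :+ con 0)) R.refl)
    pairs-size t@(node l _ r) d@(dl , dr , _) = begin-equality
      pairs t + fromℕ (size t)
        ≈⟨ R.+-cong (pairs-node l r d) (size-fromℕ l r) ⟩
      ((pairs l + pairs r) + (p * (q * 1#) + p * (q * 1#))) + (p + q)
        ≈⟨ solve 4 (λ E F p q → ((E :+ F) :+ (p :* (q :* con 1) :+ p :* (q :* con 1))) :+ (p :+ q)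
             := ((E :+ p) :+ (F :+ q)) :+ con 2 :* (p :* q)) R.refl _ _ p q ⟩
      ((pairs l + p) + (pairs r + q)) + _
        ≈⟨ R.+-congʳ (R.+-cong (pairs-size l dl) (pairs-size r dr)) ⟩
      (p * p + q * q) + _
        ≈⟨ solve 2 (λ p q → (p :* p :+ q :* q) :+ con 2 :* (p :* q) := (p :+ q) :* (p :+ q)) R.refl p q ⟩
      (p + q) * (p + q)
        ≈⟨ R.*-cong (size-fromℕ l r) (size-fromℕ l r) ⟨
      fromℕ (size t) * fromℕ (size t) ∎
      where
      p = fromℕ (size l)
      q = fromℕ (size r)

    -- A node with children of p and q leaves separates p q pairs, all at height
    -- p + q - 1.  By induction both sides become expressions in p, q and the pair
    -- sums E and F of the children, which agree because E + p = p² and F + q = q².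
    heights-pairs : ∀ t → Distinct t →
      fromℕ 3 * heights t + pairs t ≈ fromℕ 2 * fromℕ (size t) * pairs t
    heights-pairs (leaf x) _ = R.trans
      (R.+-cong (R.*-congˡ (R.+-congʳ (R.+-congʳ (R.trans (R.*-congʳ e≈0) (R.zeroˡ _))))) E≈0)
      (R.trans (solve 0 ((con 1 :+ (con 1 :+ (con 1 :+ con 0))) :* ((con 0 :+ con 0) :+ con 0) :+ con 0 := con 0) R.refl)
        (R.sym (R.trans (R.*-congˡ E≈0) (R.zeroʳ _))))
      where
      e≈0 = edgeWeight-diagonal (K n) x
      E≈0 : pairs (leaf x) ≈ 0#
      E≈0 = R.trans (R.+-congʳ (R.+-congʳ e≈0))
        (solve 0 ((con 0 :+ con 0) :+ con 0 := con 0) R.refl)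
    -- Adding 4 p q to both sides replaces the height k of the separated pairs by
    -- 1 + k = p + q, so that no subtraction occurs.
    heights-pairs t@(node l _ r) d@(dl , dr , _) = +-cancelʳ (con4 * (p * q)) _ _ (begin-equality
      (fromℕ 3 * heights t + pairs t) + con4 * (p * q)
        ≈⟨ R.+-congʳ (R.+-cong (R.*-congˡ (heights-node l r d)) (pairs-node l r d)) ⟩
      (fromℕ 3 * ((heights l + heights r) + (p * (q * k) + p * (q * k)))
        + ((pairs l + pairs r) + (p * (q * 1#) + p * (q * 1#)))) + con4 * (p * q)
        ≈⟨ solve 7 (λ p q k D₁ D₂ E₁ E₂ →
             (three :* ((D₁ :+ D₂) :+ (p :* (q :* k) :+ p :* (q :* k)))
               :+ ((E₁ :+ E₂) :+ (p :* (q :* con 1) :+ p :* (q :* con 1)))) :+ con 4 :* (p :* q)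
             := ((three :* D₁ :+ E₁) :+ (three :* D₂ :+ E₂)) :+ con 6 :* (p :* q) :* (con 1 :+ k))
             R.refl p q k _ _ _ _ ⟩
      ((fromℕ 3 * heights l + pairs l) + (fromℕ 3 * heights r + pairs r)) + _ * (1# + k)
        ≈⟨ R.+-cong (R.+-cong (heights-pairs l dl) (heights-pairs r dr))
             (R.*-congˡ (R.trans (rank-fromℕ t) (size-fromℕ l r))) ⟩
      (fromℕ 2 * p * pairs l + fromℕ 2 * q * pairs r) + _ * (p + q)
        ≈⟨ solve 4 (λ p q E₁ E₂ →
             (two :* p :* E₁ :+ two :* q :* E₂) :+ con 6 :* (p :* q) :* (p :+ q)
             := (two :* p :* E₁ :+ two :* q :* E₂ :+ con 4 :* (p :* q) :* (p :+ q))
                :+ (two :* q :* (p :* p) :+ two :* p :* (q :* q)))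
             R.refl p q _ _ ⟩
      _ + (fromℕ 2 * q * (p * p) + fromℕ 2 * p * (q * q))
        ≈⟨ R.+-congˡ (R.+-cong (R.*-congˡ (pairs-size l dl)) (R.*-congˡ (pairs-size r dr))) ⟨
      _ + (fromℕ 2 * q * (pairs l + p) + fromℕ 2 * p * (pairs r + q))
        ≈⟨ solve 4 (λ p q E₁ E₂ →
             (two :* p :* E₁ :+ two :* q :* E₂ :+ con 4 :* (p :* q) :* (p :+ q))
               :+ (two :* q :* (E₁ :+ p) :+ two :* p :* (E₂ :+ q))
             := two :* (p :+ q) :* ((E₁ :+ E₂) :+ (p :* (q :* con 1) :+ p :* (q :* con 1)))
                :+ con 4 :* (p :* q))
             R.refl p q _ _ ⟩
      fromℕ 2 * (p + q) * ((pairs l + pairs r) + (p * (q * 1#) + p * (q * 1#))) + con4 * (p * q)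
        ≈⟨ R.+-congʳ (R.*-cong (R.*-congˡ (size-fromℕ l r)) (pairs-node l r d)) ⟨
      fromℕ 2 * fromℕ (size t) * pairs t + con4 * (p * q) ∎)
      where
      p = fromℕ (size l)
      q = fromℕ (size r)
      k = fromℕ (rank t)
      con4 = 1# + 1# + 1# + 1#
      two = λ {m} → con {m} 1 :+ (con 1 :+ con 0)
      three = λ {m} → con {m} 1 :+ two

    clique-cost : ∀ t → Spans t →
      fromℕ 3 * hierarchyCost (K n) t + totalWeight (K n) ≈ fromℕ 2 * fromℕ n * totalWeight (K n)
    clique-cost t t↭ = double-cancel-≈ (begin-equality
      (fromℕ 3 * c + W) + (fromℕ 3 * c + W)
        ≈⟨ solve 3 (λ k c W → (k :* c :+ W) :+ (k :* c :+ W) := k :* (c :+ c) :+ (W :+ W)) R.refl _ _ _ ⟩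
      fromℕ 3 * (c + c) + (W + W)
        ≈⟨ R.+-cong (R.*-congˡ (R.trans (cost-doubled (K n) (λ x y → R.reflexive (cong fromℕ (treeMetric-sym rank t x y))))
                                          (∑²-↭ _ (↭-sym t↭)))) W≈ ⟩
      fromℕ 3 * heights t + pairs t
        ≈⟨ heights-pairs t (spans-distinct t t↭) ⟩
      fromℕ 2 * fromℕ (size t) * pairs t
        ≈⟨ R.*-cong (R.*-congˡ (R.reflexive (cong fromℕ (spans-size t t↭)))) (R.sym W≈) ⟩
      fromℕ 2 * fromℕ n * (W + W)
        ≈⟨ R.distribˡ _ _ _ ⟩
      fromℕ 2 * fromℕ n * W + fromℕ 2 * fromℕ n * W ∎)
      where
      c = hierarchyCost (K n) t
      W = totalWeight (K n)
      W≈ : W + W ≈ pairs t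
      W≈ = R.trans (totalWeight-doubled (K n)) (∑²-↭ _ (↭-sym t↭))

    clique-OPTcard : ∀ {a} → IsOPTcard (K n) a →
      fromℕ 3 * a + totalWeight (K n) ≈ fromℕ 2 * fromℕ n * totalWeight (K n)
    clique-OPTcard ((H , _ , cost≈a) , _) = R.trans (R.+-congʳ (R.*-congˡ (R.sym cost≈a)))
      (clique-cost (Hierarchy.tree H) (Hierarchy.leaves-↭ H))

    -- In a complete graph the uniform ultrametric dominates the graph metric.
    clique-OPTfree : ∀ {b} → Fin n → IsOPTfree (K n) b → b ≤ totalWeight (K n)
    clique-OPTfree o (_ , least) = O.trans
      (least _ (treeUltrametric (λ _ _ → ℕ.≤-refl , ℕ.≤-refl) (λ _ _ _ _ → ℕ.≤-refl) t t↭ ,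
                λ x y → fromℕ-mono-≤ (dist≤1 x y)))
      (cost-mono (K n) λ {x} {y} _ → O.trans (fromℕ-mono-≤ (treeMetric-≤ (λ _ → 1) t x y))
        (O.reflexive (R.+-identityʳ 1#)))
      where
      open WeightedGraph (K n) using (graph; dist)
      spanning : ∃[ t ] Spans t
      spanning = let t , t↭ , _ = cheapHierarchy (K n) o in t , t↭
      t  = proj₁ spanning
      t↭ = proj₂ spanning
      dist≤1 : ∀ x y → dist x y ≤ℕ treeMetric (λ _ → 1) t x y
      dist≤1 x y = bound (x ≟ y)
        where
        bound : Dec (x ≡ y) → dist x y ≤ℕ treeMetric (λ _ → 1) t x y
        bound (yes refl) = ℕ.≤-trans (ℕ.≤-reflexive (dist-refl graph x)) z≤n
        bound (no x≢y)   = ℕ.≤-trans (dist-≤ graph (x≢y ∷ []))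
          (ℕ.≤-reflexive (sym (treeMetric-≢ (λ _ → 1) t x≢y)))

  -- The ratio of the optima

  module _ {n : ℕ} {o o′ : Fin n} (o≢o′ : o ≢ o′) where

    private
      M ρ₀ : Carrier
      M = fromℕ 2 * fromℕ n - 1#
      ρ₀ = third M

    M-nonNegative : 0# ≤ M
    M-nonNegative = O.≤-respˡ-≈ (R.-‿inverseʳ 1#) (+-monoˡ-≤ (- 1#) (begin
      1#                  ≤⟨ 1≤fromℕ o ⟩
      fromℕ n             ≤⟨ x≤x+y (fromℕ-nonNegative n) ⟩
      fromℕ n + fromℕ n   ≈⟨ solve 1 (λ k → k :+ k := (con 1 :+ (con 1 :+ con 0)) :* k) R.refl (fromℕ n) ⟩
      fromℕ 2 * fromℕ n   ∎))

    module Ratio (G : WeightedGraph n) {a b : Carrier} (isA : IsOPTcard G a) (isB : IsOPTfree G b) where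
      private
        W : Carrier
        W = totalWeight G

      0<W : 0# < W
      0<W = let _ , walk = WeightedGraph.connected G o o′
                _ , o~z  = firstStep (WeightedGraph.graph G) o≢o′ walk
            in totalWeight-positive G o~z

      0≤b : 0# ≤ b
      0≤b = O.trans (proj₁ 0<W) (totalWeight≤OPTfree G isB)

      b≉0 : ¬ b ≈ 0#
      b≉0 b≈0 = proj₂ 0<W (O.antisym (proj₁ 0<W) (O.≤-respʳ-≈ b≈0 (totalWeight≤OPTfree G isB)))

      lower : 1# ≤ a / b [ b≉0 ]
      lower = ≤-/ 0≤b b≉0 (O.≤-respˡ-≈ (R.sym (R.*-identityˡ b)) (OPTfree≤OPTcard G isA isB))

      upper : a / b [ b≉0 ] ≤ ρ₀
      upper = /-≤ 0≤b b≉0 (≤-third M-nonNegative (totalWeight≤OPTfree G isB) (OPTcard-bound G o isA))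

    ratioBounds : ∀ G → ∃[ ρ ] IsOPTratio G ρ × 1# ≤ ρ × ρ ≤ ρ₀
    ratioBounds G =
      let a , isA = OPTcard-exists G o
          b , isB = OPTfree-exists G o
          open Ratio G isA isB
      in _ , (a , b , isA , isB , b≉0 , R.refl) , lower , upper

    cliqueRatio : IsOPTratio (K n) ρ₀
    cliqueRatio =
      let a , isA = OPTcard-exists (K n) o
          b , isB = OPTfree-exists (K n) o
          open Ratio (K n) isA isB
      in a , b , isA , isB , b≉0 ,
         O.antisym (≤-/ 0≤b b≉0 (third-≤ M-nonNegative (clique-OPTfree o isB)
                                  (O.reflexive (R.sym (clique-OPTcard isA)))))
                   upper

theorem7 : (ℝ : RealNumbers) → let open Optimisation ℝ in
    (n : ℕ) → 2 ≤ℕ n →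
    ((G : WeightedGraph n) →
    ∃[ ρ ] IsOPTratio G ρ × 1# ≤ ρ × ρ ≤ (fromℕ 2 * fromℕ n - 1#) / fromℕ 3 [ fromℕ-suc≉0 2 ])
    × IsOPTratio (K n) ((fromℕ 2 * fromℕ n - 1#) / fromℕ 3 [ fromℕ-suc≉0 2 ])
theorem7 ℝ (suc (suc m)) (s≤s (s≤s z≤n)) = ratioBounds ℝ 0≢1 , cliqueRatio ℝ 0≢1
  where
  0≢1 : _≢_ {A = Fin (suc (suc m))} zero (suc zero)
  0≢1 ()
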